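{- For each integer $n\ge 0$, $$5\sigma_{3}(n)-\widetilde{\sigma}_{3}(n)=48\sum_{\substack{i,j\ge 0\\ i+j=n}}\widehat{\sigma}(i)\,\widehat{\sigma}(j),$$ $$7\sigma_{5}(n)+\widetilde{\sigma}_{5}(n)=1536\sum_{\substack{i,j,k\ge 0\\ i+j+k=n}}\widehat{\sigma}(i)\,\widehat{\sigma}(j)\,\widehat{\sigma}(k),$$ where $\sigma_{3}(0)=\tfrac1{240}$, $\widetilde{\sigma}_{3}(0)=-\tfrac1{16}$, $\widehat{\sigma}(0)=\tfrac1{24}$, $\sigma_{5}(0)=-\tfrac1{504}$ and $\widetilde{\sigma}_{5}(0)=\tfrac18$.
   Context: For integers $n\ge1$, $\sigma_{s}(n)=\sum_{d\mid n}d^{s}$, $\widetilde{\sigma}_{s}(n)=\sum_{d\mid n}(-1)^{d-1}d^{s}$ and $\widehat{\sigma}(n)=\widehat{\sigma}_{1}(n)=\sum_{d\mid n}(-1)^{n/d-1}d$. Values at $n=0$ are assigned as in the claim. -}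

module Defs where

open import Data.Nat.Base as ℕ using (ℕ; zero; suc; NonZero)
open import Data.Nat.Properties as ℕ using ()
open import Data.Nat.DivMod using () renaming (_/_ to _div_)
open import Data.Nat.Divisibility using (_∣?_)
open import Data.Integer.Base as ℤ using (ℤ; +_; -1ℤ; 0ℤ)
open import Data.Rational.Base as ℚ using (ℚ; 0ℚ; _/_)
open import Data.List.Base
  using (List; map; foldr; filter; upTo; cartesianProduct)
open import Data.Product.Base using (_×_; _,_)

sumℤ : List ℤ → ℤ
sumℤ = foldr ℤ._+_ 0ℤ

sumℚ : List ℚ → ℚ
sumℚ = foldr ℚ._+_ 0ℚ

-- Sum of f d over the positive divisors d of n, for n ≥ 1.  The divisors are
-- listed as d = suc k with k < n, so that d is visibly nonzero.
∑-divisors : (n : ℕ) → ((d : ℕ) → .{{NonZero d}} → ℤ) → ℤ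
∑-divisors n f =
  sumℤ (map (λ k → f (suc k)) (filter (λ k → suc k ∣? n) (upTo n)))

-- The three divisor functions below are meaningful only for n ≥ 1; their
-- extensions to n = 0 are rational and are prescribed separately.
σ : ℕ → ℕ → ℤ
σ s n = ∑-divisors n (λ d → (+ d) ℤ.^ s)

σ~ : ℕ → ℕ → ℤ
σ~ s n = ∑-divisors n (λ d → (-1ℤ ℤ.^ (d ℕ.∸ 1)) ℤ.* ((+ d) ℤ.^ s))

σ^ : ℕ → ℤ
σ^ n = ∑-divisors n (λ d → (-1ℤ ℤ.^ ((n div d) ℕ.∸ 1)) ℤ.* (+ d))

withValueAt0 : ℚ → (ℕ → ℤ) → ℕ → ℚ
withValueAt0 q f zero      = q
withValueAt0 q f n@(suc _) = f n / 1

σ₃ σ₅ σ~₃ σ~₅ σ̂ : ℕ → ℚ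
σ₃  = withValueAt0 (+ 1 / 240)        (σ 3)
σ₅  = withValueAt0 (ℤ.- (+ 1) / 504)  (σ 5)
σ~₃ = withValueAt0 (ℤ.- (+ 1) / 16)   (σ~ 3)
σ~₅ = withValueAt0 (+ 1 / 8)          (σ~ 5)
σ̂   = withValueAt0 (+ 1 / 24)         σ^

-- All (i , j), respectively (i , j , k), of natural numbers with the given
-- sum n; each entry is necessarily at most n.
pairs : ℕ → List (ℕ × ℕ)
pairs n = filter (λ (i , j) → i ℕ.+ j ℕ.≟ n)
  (cartesianProduct (upTo (suc n)) (upTo (suc n)))

triples : ℕ → List (ℕ × ℕ × ℕ)
triples n = filter (λ (i , j , k) → i ℕ.+ j ℕ.+ k ℕ.≟ n)
  (cartesianProduct (upTo (suc n))
    (cartesianProduct (upTo (suc n)) (upTo (suc n))))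

{-# OPTIONS --safe #-}
module Submission where

-- Both σ̂(n) = ∑_{e x = n} (-1)^(x-1) e and σ̂(n) = ∑_{e x = n, e odd} e hold, so that ∑ σ̂(i) σ̂(j) is a
-- sum of a b over the positive solutions of a x + b y = n with a and b odd.  Such sums are evaluated
-- by Liouville's method: (a , b , x , x + y) ↦ (a + b , b , x , y) is a bijection from the solutions
-- with x < y to those with b < a.  If a weight F is invariant under it, then the parts x > y and
-- a < b of the sum of F differ only by the diagonal parts a = b and x = y, which are divisor sums.
-- The weights [a odd] [b even] bᵏ and (-1)ˣ bᵏ yield the sums of w ((b - a)ᵏ - (a + b)ᵏ) for
-- w = [a odd] [b odd] and w = (-1)^(x+y) respectively.
-- The first identity is the case k = 2 of the former.  It also shows that the square of the series
-- of σ̂ is proportional to the difference of 2 ∑_{b y = n} (-1)^(y-1) b³ and ∑_{b y = n, b odd} b³.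
-- Multiplying by σ̂, written as a sum of the matching kind, reduces the second identity to k = 4.

open import Data.Bool.Base using (if_then_else_; true; false)
open import Data.Fin.Base using (toℕ)
open import Data.Integer.Base as ℤ using (ℤ; +_; 0ℤ; 1ℤ; -1ℤ)
open import Data.Integer.Solver using (module +-*-Solver)
open import Data.List.Base using (List; []; _∷_; _++_; map; filter; applyUpTo; upTo; cartesianProduct)
open import Data.List.Properties using (map-++; map-∘)
open import Data.Nat.Base as ℕ using (ℕ; zero; suc; z≤n; s≤s; z<s; s<s; _≤_; _<_; NonZero)
open import Data.Nat.Divisibility using (_∣_; _∣?_; divides)
open import Data.Nat.DivMod using (m*n/n≡m) renaming (_/_ to _div_)
import Data.Nat.Properties as ℕ
import Data.Nat.Solver as ℕ
open import Data.Product.Base using (_×_; _,_)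
import Data.Rational.Properties as ℚ
import Data.Rational.Solver as ℚ
open import Data.Rational.Unnormalised.Base using (mkℚᵘ; *≡*)
import Data.Rational.Unnormalised.Properties as ℚᵘ
open import Data.Sum.Base using (_⊎_; inj₁; inj₂)
open import Function.Base using (_∘_; flip; id)
open import Relation.Binary.PropositionalEquality
  using (_≡_; _≢_; refl; sym; trans; cong; cong₂; subst; module ≡-Reasoning)
open import Relation.Nullary using (Dec; yes; no; does; contradiction)
open import Relation.Nullary.Decidable using (dec-true; dec-false)
open import Relation.Unary using (Decidable)
open import Defs

open ≡-Reasoning
open +-*-Solver using (solve; _:+_; _:*_; _:-_; _:^_; :-_; _:=_; con; Polynomial)

-- The two parts a < b and b < a have to be exchanged by symmetry, so the method reaches only
-- products w(a, x) w(b, y) with the same w at both places. This is the obstacle in the cube: the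
-- square of the series of σ̂ contains b³ over even b, and its product with a sum over odd a mixes
-- parities. The relation 4 X = - (4 O + 3 V) between the cubes with sign (-1)^x, over odd divisors
-- and over even divisors absorbs V entirely. Only X and O remain, and each meets its own kind in
-- one of the two expressions for σ̂. The value σ̂(0) = 1/24 is exactly what removes the lower
-- powers: the closed forms of the power sums leave first and third powers behind, and the terms
-- with a zero index cancel them. All sums run over boxes with an indicator of the equation.
-- Bijections then become polynomial identities between indices, provided that an ordered pair is
-- described by its smaller entry and the difference; no subtraction of naturals is needed to state
-- them.

# : ∀ {n} → ℕ → Polynomial n
# m = con (+ m)

module ℕˢ = ℕ.+-*-Solver
module ℚˢ = ℚ.+-*-Solver

module _ where
  open import Data.Integer.Base using (_+_; _*_; _-_; -_; _^_)
  open import Data.Integer.Properties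
  open import Algebra.Properties.AbelianGroup +-0-abelianGroup using (∙-cancelˡ)
  open import Algebra.Properties.Semiring.Sum +-*-semiring using (sum; ∑-distrib-+; *-distribˡ-sum)

  -- Finite sums

  ∑ : ℕ → (ℕ → ℤ) → ℤ
  ∑ zero    f = 0ℤ
  ∑ (suc n) f = f 1 + ∑ n (f ∘ suc)

  infixl 10 ∑
  syntax ∑ n (λ d → t) = ∑[ d ≤ n ] t

  ∑-cong : ∀ n {f g} → (∀ d → f (suc d) ≡ g (suc d)) → ∑ n f ≡ ∑ n g
  ∑-cong zero    f≗g = refl
  ∑-cong (suc n) f≗g = cong₂ _+_ (f≗g 0) (∑-cong n (f≗g ∘ suc))

  ∑≡sum : ∀ n f → ∑ n f ≡ sum {n} (λ i → f (suc (toℕ i)))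
  ∑≡sum zero    f = refl
  ∑≡sum (suc n) f = cong (_+_ (f 1)) (∑≡sum n (f ∘ suc))

  ∑-+ : ∀ n f g → ∑[ d ≤ n ] (f d + g d) ≡ ∑ n f + ∑ n g
  ∑-+ n f g = begin
    ∑[ d ≤ n ] (f d + g d)
      ≡⟨ ∑≡sum n (λ d → f d + g d) ⟩
    sum {n} (λ i → f (suc (toℕ i)) + g (suc (toℕ i)))
      ≡⟨ ∑-distrib-+ {n} (λ i → f (suc (toℕ i))) (λ i → g (suc (toℕ i))) ⟩
    sum {n} (λ i → f (suc (toℕ i))) + sum {n} (λ i → g (suc (toℕ i)))
      ≡⟨ sym (cong₂ _+_ (∑≡sum n f) (∑≡sum n g)) ⟩
    ∑ n f + ∑ n g ∎

  ∑-*ˡ : ∀ n c f → ∑[ d ≤ n ] (c * f d) ≡ c * ∑ n f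
  ∑-*ˡ n c f = begin
    ∑[ d ≤ n ] (c * f d)                    ≡⟨ ∑≡sum n (λ d → c * f d) ⟩
    sum {n} (λ i → c * f (suc (toℕ i)))     ≡⟨ sym (*-distribˡ-sum {n} c (λ i → f (suc (toℕ i)))) ⟩
    c * sum {n} (λ i → f (suc (toℕ i)))     ≡⟨ cong (c *_) (sym (∑≡sum n f)) ⟩
    c * ∑ n f                               ∎

  ∑-zero : ∀ n {f} → (∀ d → f (suc d) ≡ 0ℤ) → ∑ n f ≡ 0ℤ
  ∑-zero zero    f≗0 = refl
  ∑-zero (suc n) f≗0 = cong₂ _+_ (f≗0 0) (∑-zero n (f≗0 ∘ suc))

  ∑-swap : ∀ m n (h : ℕ → ℕ → ℤ) →
           ∑[ i ≤ m ] ∑[ j ≤ n ] h i j ≡ ∑[ j ≤ n ] ∑[ i ≤ m ] h i j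
  ∑-swap zero    n h = sym (∑-zero n (λ _ → refl))
  ∑-swap (suc m) n h = begin
    ∑ n (h 1) + ∑[ i ≤ m ] ∑[ j ≤ n ] h (suc i) j
      ≡⟨ cong (_+_ (∑ n (h 1))) (∑-swap m n (h ∘ suc)) ⟩
    ∑ n (h 1) + ∑[ j ≤ n ] ∑[ i ≤ m ] h (suc i) j
      ≡⟨ sym (∑-+ n (h 1) _) ⟩
    ∑[ j ≤ n ] (h 1 j + ∑[ i ≤ m ] h (suc i) j) ∎

  ∑-last : ∀ n f → ∑ (suc n) f ≡ ∑ n f + f (suc n)
  ∑-last zero    f = +-comm (f 1) 0ℤ
  ∑-last (suc n) f = trans (cong (_+_ (f 1)) (∑-last n (f ∘ suc)))
                           (sym (+-assoc (f 1) _ _))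

  ∑-extend : ∀ {m n} f → m ≤ n → (∀ d → m < d → f d ≡ 0ℤ) → ∑ n f ≡ ∑ m f
  ∑-extend {n = n} f z≤n       f≡0 = ∑-zero n (λ d → f≡0 (suc d) z<s)
  ∑-extend         f (s≤s m≤n) f≡0 =
    cong (_+_ (f 1)) (∑-extend (f ∘ suc) m≤n (λ d m<d → f≡0 (suc d) (s<s m<d)))

  ∑-single : ∀ n {k} f → k < n → (∀ d → d ≢ k → f (suc d) ≡ 0ℤ) → ∑ n f ≡ f (suc k)
  ∑-single (suc n) {zero}  f _ f≡0 =
    trans (cong (_+_ (f 1)) (∑-zero n (λ d → f≡0 (suc d) λ ()))) (+-identityʳ _)
  ∑-single (suc n) {suc k} f (s≤s k<n) f≡0 =
    trans (cong (_+ ∑ n (f ∘ suc)) (f≡0 0 λ ()))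
          (trans (+-identityˡ _)
            (∑-single n (f ∘ suc) k<n (λ d d≢k → f≡0 (suc d) (d≢k ∘ ℕ.suc-injective))))

  ∑-double : ∀ n f → ∑ (n ℕ.+ n) f ≡ ∑ n (λ d → f (d ℕ.+ d ℕ.∸ 1) + f (d ℕ.+ d))
  ∑-double zero    f = refl
  ∑-double (suc n) f = begin
    f 1 + ∑ (n ℕ.+ suc n) (f ∘ suc)
      ≡⟨ cong (λ m → f 1 + ∑ m (f ∘ suc)) (ℕ.+-suc n n) ⟩
    f 1 + (f 2 + ∑ (n ℕ.+ n) (f ∘ suc ∘ suc))
      ≡⟨ sym (+-assoc (f 1) (f 2) _) ⟩
    f 1 + f 2 + ∑ (n ℕ.+ n) (f ∘ suc ∘ suc)
      ≡⟨ cong (_+_ (f 1 + f 2)) (∑-double n (f ∘ suc ∘ suc)) ⟩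
    f 1 + f 2 + ∑ n (λ d → f (2 ℕ.+ (d ℕ.+ d ℕ.∸ 1)) + f (2 ℕ.+ (d ℕ.+ d)))
      ≡⟨ cong (_+_ (f 1 + f 2)) (∑-cong n λ d → cong₂ _+_
           (cong (f ∘ suc) (sym (ℕ.+-suc d (suc d))))
           (cong (f ∘ suc ∘ suc) (sym (ℕ.+-suc d (suc d))))) ⟩
    f 1 + f 2 + ∑ n (λ d → f (suc d ℕ.+ suc d ℕ.∸ 1) + f (suc d ℕ.+ suc d)) ∎

  VanishesBeyond : ℕ → (ℕ → ℕ → ℤ) → Set
  VanishesBeyond n h = ∀ i j → n < i ⊎ n < j → h i j ≡ 0ℤ

  -- The off-diagonal parts are indexed by the smaller entry and the positive difference. Letting
  -- the difference run up to `n` as well overshoots the square, which is harmless because `h`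
  -- vanishes there.
  ∑-trichotomy : ∀ n {h} → VanishesBeyond n h →
    ∑[ i ≤ n ] ∑[ j ≤ n ] h i j ≡
      ∑[ i ≤ n ] ∑[ k ≤ n ] h i (i ℕ.+ k) + ∑[ i ≤ n ] h i i
        + ∑[ k ≤ n ] ∑[ j ≤ n ] h (j ℕ.+ k) j
  ∑-trichotomy n {h} van =
    trans (go n n h ℕ.≤-refl van)
          (cong (_+_ (∑[ i ≤ n ] ∑[ k ≤ n ] h i (i ℕ.+ k) + ∑[ i ≤ n ] h i i))
                (∑-swap n n (λ j k → h (j ℕ.+ k) j)))
    where
    -- The range `N` of the difference stays fixed while the side `m` of the square shrinks: each
    -- step removes the first row, the first column and their corner.
    go : ∀ m N (h : ℕ → ℕ → ℤ) → m ≤ N → VanishesBeyond m h →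
      ∑[ i ≤ m ] ∑[ j ≤ m ] h i j ≡
        ∑[ i ≤ m ] ∑[ k ≤ N ] h i (i ℕ.+ k) + ∑[ i ≤ m ] h i i
          + ∑[ j ≤ m ] ∑[ k ≤ N ] h (j ℕ.+ k) j
    go zero    N h _ _ = refl
    go (suc m) N h m<N van = begin
      h 1 1 + row + ∑[ i ≤ m ] (h (suc i) 1 + ∑[ j ≤ m ] h (suc i) (suc j))
        ≡⟨ cong (_+_ (h 1 1 + row)) (∑-+ m (λ i → h (suc i) 1) (λ i → ∑[ j ≤ m ] h (suc i) (suc j))) ⟩
      h 1 1 + row + (col + ∑[ i ≤ m ] ∑[ j ≤ m ] h (suc i) (suc j))
        ≡⟨ cong (λ t → h 1 1 + row + (col + t))
             (go m N (λ i j → h (suc i) (suc j)) (ℕ.<⇒≤ m<N)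
                 (λ { i j (inj₁ m<i) → van _ _ (inj₁ (s<s m<i))
                    ; i j (inj₂ m<j) → van _ _ (inj₂ (s<s m<j)) })) ⟩
      h 1 1 + row + (col + (upper + diag + lower))
        ≡⟨ solve 6 (λ c r l u d w → c :+ r :+ (l :+ (u :+ d :+ w)) :=
                                    (r :+ u) :+ (c :+ d) :+ (l :+ w))
             refl (h 1 1) row col upper diag lower ⟩
      (row + upper) + (h 1 1 + diag) + (col + lower)
        ≡⟨ cong₂ (λ r l → (r + upper) + (h 1 1 + diag) + (l + lower))
             (sym (∑-extend (λ k → h 1 (suc k)) (ℕ.<⇒≤ m<N) λ k m<k → van _ _ (inj₂ (s<s m<k))))
             (sym (∑-extend (λ k → h (suc k) 1) (ℕ.<⇒≤ m<N) λ k m<k → van _ _ (inj₁ (s<s m<k)))) ⟩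
      _ ∎
      where
      row = ∑[ j ≤ m ] h 1 (suc j)
      col = ∑[ i ≤ m ] h (suc i) 1
      upper = ∑[ i ≤ m ] ∑[ k ≤ N ] h (suc i) (suc (i ℕ.+ k))
      diag = ∑[ i ≤ m ] h (suc i) (suc i)
      lower = ∑[ j ≤ m ] ∑[ k ≤ N ] h (suc (j ℕ.+ k)) (suc j)

  -- Regroup by the total e = j + i. Since i is positive, j stops at e - 1, and totals beyond `n`
  -- contribute nothing.
  ∑-antidiagonals : ∀ n h → (∀ e j → n < e → h e j ≡ 0ℤ) →
    ∑[ j ≤ n ] ∑[ i ≤ n ] h (j ℕ.+ i) j ≡ ∑[ e ≤ n ] ∑[ j ≤ e ℕ.∸ 1 ] h e j
  ∑-antidiagonals n h van = go n n h ℕ.≤-refl van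
    where
    go : ∀ m N (h : ℕ → ℕ → ℤ) → m ≤ N → (∀ e j → m < e → h e j ≡ 0ℤ) →
      ∑[ j ≤ m ] ∑[ i ≤ N ] h (j ℕ.+ i) j ≡ ∑[ e ≤ m ] ∑[ j ≤ e ℕ.∸ 1 ] h e j
    go zero    N h _   _   = refl
    go (suc m) N h m<N van = begin
      ∑[ i ≤ N ] h (suc i) 1 + ∑[ j ≤ m ] ∑[ i ≤ N ] h (suc (j ℕ.+ i)) (suc j)
        ≡⟨ cong₂ _+_
             (∑-extend (λ i → h (suc i) 1) (ℕ.<⇒≤ m<N) λ i m<i → van _ _ (s<s m<i))
             (go m N (λ e j → h (suc e) (suc j)) (ℕ.<⇒≤ m<N) λ e j m<e → van _ _ (s<s m<e)) ⟩
      ∑[ e ≤ m ] h (suc e) 1 + ∑[ e ≤ m ] ∑[ j ≤ e ℕ.∸ 1 ] h (suc e) (suc j)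
        ≡⟨ sym (∑-+ m (λ e → h (suc e) 1) (λ e → ∑[ j ≤ e ℕ.∸ 1 ] h (suc e) (suc j))) ⟩
      ∑[ e ≤ m ] (h (suc e) 1 + ∑[ j ≤ e ℕ.∸ 1 ] h (suc e) (suc j))
        ≡⟨ ∑-cong m (λ _ → refl) ⟩
      ∑[ e ≤ m ] ∑[ j ≤ e ] h (suc e) j
        -- The total e = 1 leaves no room for j, so its inner sum is 0.
        ≡⟨ sym (+-identityˡ _) ⟩
      0ℤ + ∑[ e ≤ m ] ∑[ j ≤ e ] h (suc e) j ∎

  -- Sums over factorisations and over solutions of a x + b y = n

  opaque
    -- An Iverson bracket with a value attached. It is opaque, so that goals keep it as a symbol;
    -- outside this block it is governed by `δ-if`, `δ-≢` and `δ-≡` alone.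
    δ : ℕ → ℕ → ℤ → ℤ
    δ m n i = if does (m ℕ.≟ n) then i else 0ℤ

    δ-if : ∀ m n i → δ m n i ≡ (if does (m ℕ.≟ n) then i else 0ℤ)
    δ-if m n i = refl

    δ-≢ : ∀ {m n} i → m ≢ n → δ m n i ≡ 0ℤ
    δ-≢ {m} {n} i m≢n = cong (if_then i else 0ℤ) (dec-false (m ℕ.≟ n) m≢n)

    δ-≡ : ∀ {m n} i → m ≡ n → δ m n i ≡ i
    δ-≡ {m} {n} i m≡n = cong (if_then i else 0ℤ) (dec-true (m ℕ.≟ n) m≡n)

  δ-> : ∀ {m n} i → n < m → δ m n i ≡ 0ℤ
  δ-> i n<m = δ-≢ i (ℕ.<⇒≢ n<m ∘ sym)

  -- The values need to agree only where the bracket is nonzero. Inside a sum over i + j = n one may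
  -- thus argue from that equation, for instance to obtain i ≤ n.
  δ-cong : ∀ {m n i j} → (m ≡ n → i ≡ j) → δ m n i ≡ δ m n j
  δ-cong {m} {n} {i} {j} i≡j with m ℕ.≟ n
  ... | yes m≡n = cong (δ m n) (i≡j m≡n)
  ... | no  m≢n = trans (δ-≢ i m≢n) (sym (δ-≢ j m≢n))

  δ-map : ∀ m n (f : ℤ → ℤ) i → f 0ℤ ≡ 0ℤ → δ m n (f i) ≡ f (δ m n i)
  δ-map m n f i f0≡0 with m ℕ.≟ n
  ... | yes m≡n = trans (δ-≡ (f i) m≡n) (cong f (sym (δ-≡ i m≡n)))
  ... | no  m≢n = trans (δ-≢ (f i) m≢n) (trans (sym f0≡0) (cong f (sym (δ-≢ i m≢n))))

  δ-* : ∀ m n c i → δ m n (c * i) ≡ c * δ m n i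
  δ-* m n c i = δ-map m n (c *_) i (*-zeroʳ c)

  δ-+ : ∀ m n i j → δ m n (i + j) ≡ δ m n i + δ m n j
  δ-+ m n i j with m ℕ.≟ n
  ... | yes m≡n = trans (δ-≡ (i + j) m≡n) (sym (cong₂ _+_ (δ-≡ i m≡n) (δ-≡ j m≡n)))
  ... | no  m≢n = trans (δ-≢ (i + j) m≢n) (sym (cong₂ _+_ (δ-≢ i m≢n) (δ-≢ j m≢n)))

  δ-∑ : ∀ m n N f → ∑ N (λ d → δ m n (f d)) ≡ δ m n (∑ N f)
  δ-∑ m n zero    f = sym (δ-map m n (λ _ → 0ℤ) 0ℤ refl)
  δ-∑ m n (suc N) f = trans (cong (_+_ (δ m n (f 1))) (δ-∑ m n N (f ∘ suc)))
                            (sym (δ-+ m n (f 1) (∑ N (f ∘ suc))))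

  ∑² : ℕ → (ℕ → ℕ → ℤ) → ℤ
  ∑² n f = ∑[ i ≤ n ] ∑[ j ≤ n ] f i j

  ∑²-cong : ∀ n {f g : ℕ → ℕ → ℤ} → (∀ i j → f (suc i) (suc j) ≡ g (suc i) (suc j)) →
            ∑² n f ≡ ∑² n g
  ∑²-cong n f≗g = ∑-cong n λ i → ∑-cong n (f≗g i)

  ∑²-+ : ∀ n (f g : ℕ → ℕ → ℤ) → ∑² n (λ i j → f i j + g i j) ≡ ∑² n f + ∑² n g
  ∑²-+ n f g = trans (∑-cong n λ i → ∑-+ n (f (suc i)) (g (suc i)))
                     (∑-+ n (λ i → ∑ n (f i)) (λ i → ∑ n (g i)))

  ∑²-*ˡ : ∀ n c (f : ℕ → ℕ → ℤ) → ∑² n (λ i j → c * f i j) ≡ c * ∑² n f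
  ∑²-*ˡ n c f = trans (∑-cong n λ i → ∑-*ˡ n c (f (suc i)))
                      (∑-*ˡ n c (λ i → ∑ n (f i)))

  ∑²-zero : ∀ n {f : ℕ → ℕ → ℤ} → (∀ i j → f (suc i) (suc j) ≡ 0ℤ) → ∑² n f ≡ 0ℤ
  ∑²-zero n f≗0 = ∑-zero n λ i → ∑-zero n (f≗0 i)

  ∑²-flip : ∀ n (f : ℕ → ℕ → ℤ) → ∑² n f ≡ ∑² n (flip f)
  ∑²-flip n f = ∑-swap n n f

  ∑²-swap : ∀ n (f : ℕ → ℕ → ℕ → ℕ → ℤ) →
            ∑² n (λ i j → ∑² n (λ k l → f i j k l)) ≡ ∑² n (λ k l → ∑² n (λ i j → f i j k l))
  ∑²-swap n f = begin
    ∑[ i ≤ n ] ∑[ j ≤ n ] ∑[ k ≤ n ] ∑[ l ≤ n ] f i j k l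
      ≡⟨ ∑-cong n (λ i → ∑-swap n n λ j k → ∑ n (f (suc i) j k)) ⟩
    ∑[ i ≤ n ] ∑[ k ≤ n ] ∑[ j ≤ n ] ∑[ l ≤ n ] f i j k l
      ≡⟨ ∑-swap n n (λ i k → ∑[ j ≤ n ] ∑[ l ≤ n ] f i j k l) ⟩
    ∑[ k ≤ n ] ∑[ i ≤ n ] ∑[ j ≤ n ] ∑[ l ≤ n ] f i j k l
      ≡⟨ ∑²-cong n (λ k i → ∑-swap n n λ j l → f (suc i) j (suc k) l) ⟩
    ∑[ k ≤ n ] ∑[ i ≤ n ] ∑[ l ≤ n ] ∑[ j ≤ n ] f i j k l
      ≡⟨ ∑-cong n (λ k → ∑-swap n n λ i l → ∑[ j ≤ n ] f i j (suc k) l) ⟩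
    ∑[ k ≤ n ] ∑[ l ≤ n ] ∑[ i ≤ n ] ∑[ j ≤ n ] f i j k l ∎

  -- D N n f is the sum of f e x over the factorisations e x = n with e, x ≤ N.
  D : ℕ → ℕ → (ℕ → ℕ → ℤ) → ℤ
  D N n f = ∑² N λ e x → δ (e ℕ.* x) n (f e x)

  -- Every entry of a positive solution of a x + b y = n is at most n, so the box loses none of
  -- them.
  Q : ℕ → (ℕ → ℕ → ℕ → ℕ → ℤ) → ℤ
  Q n F = ∑² n λ a b → ∑² n λ x y → δ (a ℕ.* x ℕ.+ b ℕ.* y) n (F a b x y)

  -- Liouville's identity

  m<1+n*m : ∀ {m n} k → n < m → n < suc k ℕ.* m
  m<1+n*m k n<m = ℕ.≤-trans n<m (ℕ.m≤m+n _ _)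

  module Trichotomy (n : ℕ) where

    -- The parts x < y, x = y, x > y and a < b, a = b, a > b of Q n F, parametrised by the smaller
    -- entry and the difference.
    xUp xDiag xLow aUp aDiag aLow : (ℕ → ℕ → ℕ → ℕ → ℤ) → ℤ
    xUp   F = ∑² n λ a b → ∑² n λ x y → δ (a ℕ.* x ℕ.+ b ℕ.* (x ℕ.+ y)) n (F a b x (x ℕ.+ y))
    xDiag F = ∑² n λ a b → ∑[ x ≤ n ] (δ (a ℕ.* x ℕ.+ b ℕ.* x) n (F a b x x))
    xLow  F = ∑² n λ a b → ∑² n λ x y → δ (a ℕ.* (y ℕ.+ x) ℕ.+ b ℕ.* y) n (F a b (y ℕ.+ x) y)
    aUp   F = ∑² n λ a b → ∑² n λ x y → δ (a ℕ.* x ℕ.+ (a ℕ.+ b) ℕ.* y) n (F a (a ℕ.+ b) x y)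
    aDiag F = ∑[ a ≤ n ] ∑² n λ x y → δ (a ℕ.* x ℕ.+ a ℕ.* y) n (F a a x y)
    aLow  F = ∑² n λ a b → ∑² n λ x y → δ ((b ℕ.+ a) ℕ.* x ℕ.+ b ℕ.* y) n (F (b ℕ.+ a) b x y)

    Q-x : ∀ F → Q n F ≡ xUp F + xDiag F + xLow F
    Q-x F = begin
      Q n F
        ≡⟨ ∑²-cong n (λ a b → ∑-trichotomy n (vanish a b)) ⟩
      (∑² n λ a b → u a b + d a b + l a b)
        ≡⟨ ∑²-+ n (λ a b → u a b + d a b) l ⟩
      (∑² n λ a b → u a b + d a b) + ∑² n l
        ≡⟨ cong (_+ ∑² n l) (∑²-+ n u d) ⟩
      xUp F + xDiag F + xLow F ∎
      where
      u d l : ℕ → ℕ → ℤ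
      u a b = ∑² n λ x y → δ (a ℕ.* x ℕ.+ b ℕ.* (x ℕ.+ y)) n (F a b x (x ℕ.+ y))
      d a b = ∑[ x ≤ n ] (δ (a ℕ.* x ℕ.+ b ℕ.* x) n (F a b x x))
      l a b = ∑² n λ x y → δ (a ℕ.* (y ℕ.+ x) ℕ.+ b ℕ.* y) n (F a b (y ℕ.+ x) y)
      vanish : ∀ a b → VanishesBeyond n λ x y →
        δ (suc a ℕ.* x ℕ.+ suc b ℕ.* y) n (F (suc a) (suc b) x y)
      vanish a b x y (inj₁ n<x) = δ-> _ (ℕ.≤-trans (m<1+n*m a n<x) (ℕ.m≤m+n (suc a ℕ.* x) _))
      vanish a b x y (inj₂ n<y) = δ-> _ (ℕ.≤-trans (m<1+n*m b n<y) (ℕ.m≤n+m _ (suc a ℕ.* x)))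

    Q-a : ∀ F → Q n F ≡ aUp F + aDiag F + aLow F
    Q-a F = ∑-trichotomy n vanish
      where
      vanish : VanishesBeyond n λ a b →
        ∑² n λ x y → δ (a ℕ.* x ℕ.+ b ℕ.* y) n (F a b x y)
      vanish a b (inj₁ n<a) = ∑²-zero n λ x y → δ-> _
        (ℕ.≤-trans (subst (n <_) (ℕ.*-comm (suc x) a) (m<1+n*m x n<a)) (ℕ.m≤m+n _ _))
      vanish a b (inj₂ n<b) = ∑²-zero n λ x y → δ-> _
        (ℕ.≤-trans (subst (n <_) (ℕ.*-comm (suc y) b) (m<1+n*m y n<b)) (ℕ.m≤n+m _ _))

    term-cong : ∀ {k l i j} → k ≡ l → i ≡ j → δ k n i ≡ δ l n j
    term-cong = cong₂ (λ k i → δ k n i)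

    -- The product b x moves between the two summands, so that solutions with x < y correspond to
    -- those with b < a.
    shift-x : ∀ a b x y → (b ℕ.+ a) ℕ.* x ℕ.+ b ℕ.* y ≡ a ℕ.* x ℕ.+ b ℕ.* (x ℕ.+ y)
    shift-x = ℕˢ.solve 4 (λ a b x y →
      (b ℕˢ.:+ a) ℕˢ.:* x ℕˢ.:+ b ℕˢ.:* y ℕˢ.:= a ℕˢ.:* x ℕˢ.:+ b ℕˢ.:* (x ℕˢ.:+ y)) refl

    -- The mirror image, between a < b and y < x. In `liouville` it relates `G` and `H` to `F`,
    -- whereas `shift-x` relates `F` to itself.
    shift-a : ∀ a b x y → a ℕ.* x ℕ.+ (a ℕ.+ b) ℕ.* y ≡ a ℕ.* (y ℕ.+ x) ℕ.+ b ℕ.* y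
    shift-a = ℕˢ.solve 4 (λ a b x y →
      a ℕˢ.:* x ℕˢ.:+ (a ℕˢ.:+ b) ℕˢ.:* y ℕˢ.:= a ℕˢ.:* (y ℕˢ.:+ x) ℕˢ.:+ b ℕˢ.:* y) refl

    Symmetric : (ℕ → ℕ → ℕ → ℕ → ℤ) → Set
    Symmetric F = ∀ a b x y → F b a y x ≡ F a b x y

    -- Exchanging (a, x) with (b, y) preserves the equation and turns b < a into a < b.
    aLow≡aUp : ∀ F → Symmetric F → aLow F ≡ aUp F
    aLow≡aUp F F-sym = begin
      aLow F
        ≡⟨ ∑²-cong n (λ a b → ∑²-flip n λ x y →
             δ ((suc b ℕ.+ suc a) ℕ.* x ℕ.+ suc b ℕ.* y) n (F (suc b ℕ.+ suc a) (suc b) x y)) ⟩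
      (∑² n λ a b → ∑² n λ y x → δ ((b ℕ.+ a) ℕ.* x ℕ.+ b ℕ.* y) n (F (b ℕ.+ a) b x y))
        ≡⟨ ∑²-flip n (λ a b → ∑² n λ y x → δ ((b ℕ.+ a) ℕ.* x ℕ.+ b ℕ.* y) n (F (b ℕ.+ a) b x y)) ⟩
      (∑² n λ b a → ∑² n λ y x → δ ((b ℕ.+ a) ℕ.* x ℕ.+ b ℕ.* y) n (F (b ℕ.+ a) b x y))
        ≡⟨ ∑²-cong n (λ b a → ∑²-cong n λ y x →
             term-cong (ℕ.+-comm ((suc b ℕ.+ suc a) ℕ.* suc x) (suc b ℕ.* suc y)) (F-sym _ _ _ _)) ⟩
      aUp F ∎

    xUp≡xLow : ∀ F → Symmetric F → xUp F ≡ xLow F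
    xUp≡xLow F F-sym = begin
      xUp F
        ≡⟨ ∑²-cong n (λ a b → ∑²-flip n λ x y →
             δ (suc a ℕ.* x ℕ.+ suc b ℕ.* (x ℕ.+ y)) n (F (suc a) (suc b) x (x ℕ.+ y))) ⟩
      (∑² n λ a b → ∑² n λ y x → δ (a ℕ.* x ℕ.+ b ℕ.* (x ℕ.+ y)) n (F a b x (x ℕ.+ y)))
        ≡⟨ ∑²-flip n (λ a b → ∑² n λ y x → δ (a ℕ.* x ℕ.+ b ℕ.* (x ℕ.+ y)) n (F a b x (x ℕ.+ y))) ⟩
      (∑² n λ b a → ∑² n λ y x → δ (a ℕ.* x ℕ.+ b ℕ.* (x ℕ.+ y)) n (F a b x (x ℕ.+ y)))
        ≡⟨ ∑²-cong n (λ b a → ∑²-cong n λ y x →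
             term-cong (ℕ.+-comm (suc a ℕ.* suc x) (suc b ℕ.* (suc x ℕ.+ suc y))) (F-sym _ _ _ _)) ⟩
      xLow F ∎

    -- `G` and `H` complete parts of `F` to full sums. By symmetry `Q n G` is twice its part a < b
    -- plus a diagonal, and this part is the part x > y of `F`. Likewise `Q n H` is twice its part x
    -- > y plus a diagonal, and this part is the part a < b of `F`. What remains is a difference of
    -- two parts of `F`, given by its diagonals.
    liouville : ∀ F G H → Symmetric G → Symmetric H →
      (∀ a b x y → F (b ℕ.+ a) b x y ≡ F a b x (x ℕ.+ y)) →
      (∀ a b x y → G a (a ℕ.+ b) x y ≡ F a b (y ℕ.+ x) y) →
      (∀ a b x y → H a b (y ℕ.+ x) y ≡ F a (a ℕ.+ b) x y) →
      Q n G - Q n H ≡ + 2 * (aDiag F - xDiag F) + aDiag G - xDiag H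
    liouville F G H G-sym H-sym F-inv G-F H-F = begin
      Q n G - Q n H
        ≡⟨ cong₂ _-_ (Q-a G) (Q-x H) ⟩
      (aUp G + aDiag G + aLow G) - (xUp H + xDiag H + xLow H)
        ≡⟨ cong₂ (λ s t → (aUp G + aDiag G + s) - (t + xDiag H + xLow H))
             (aLow≡aUp G G-sym) (xUp≡xLow H H-sym) ⟩
      (aUp G + aDiag G + aUp G) - (xLow H + xDiag H + xLow H)
        ≡⟨ cong₂ (λ s t → (s + aDiag G + s) - (t + xDiag H + t)) aUpG≡xLowF xLowH≡aUpF ⟩
      (xLow F + aDiag G + xLow F) - (aUp F + xDiag H + aUp F)
        ≡⟨ solve 6 (λ aD xD g h u v →
             v :+ g :+ v :- (u :+ h :+ u) :=
             # 2 :* (aD :- xD) :+ g :- h :+ # 2 :* ((xD :+ v) :- (u :+ aD)))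
             refl (aDiag F) (xDiag F) (aDiag G) (xDiag H) (aUp F) (xLow F) ⟩
      + 2 * (aDiag F - xDiag F) + aDiag G - xDiag H + + 2 * ((xDiag F + xLow F) - (aUp F + aDiag F))
        ≡⟨ cong (λ t → + 2 * (aDiag F - xDiag F) + aDiag G - xDiag H + + 2 * t)
                (i≡j⇒i-j≡0 balance) ⟩
      + 2 * (aDiag F - xDiag F) + aDiag G - xDiag H + 0ℤ
        ≡⟨ +-identityʳ _ ⟩
      + 2 * (aDiag F - xDiag F) + aDiag G - xDiag H ∎
      where
      aLowF≡xUpF : aLow F ≡ xUp F
      aLowF≡xUpF = ∑²-cong n λ a b → ∑²-cong n λ x y →
        term-cong (shift-x (suc a) (suc b) (suc x) (suc y)) (F-inv _ _ _ _)
      aUpG≡xLowF : aUp G ≡ xLow F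
      aUpG≡xLowF = ∑²-cong n λ a b → ∑²-cong n λ x y →
        term-cong (shift-a (suc a) (suc b) (suc x) (suc y)) (G-F _ _ _ _)
      xLowH≡aUpF : xLow H ≡ aUp F
      xLowH≡aUpF = ∑²-cong n λ a b → ∑²-cong n λ x y →
        term-cong (sym (shift-a (suc a) (suc b) (suc x) (suc y))) (H-F _ _ _ _)
      -- Split `Q n F` in both ways and cancel the common part: x < y in one splitting is b < a in
      -- the other.
      balance : xDiag F + xLow F ≡ aUp F + aDiag F
      balance = ∙-cancelˡ (xUp F) _ _ (begin
        xUp F + (xDiag F + xLow F)  ≡⟨ sym (+-assoc (xUp F) _ _) ⟩
        xUp F + xDiag F + xLow F    ≡⟨ sym (Q-x F) ⟩
        Q n F                       ≡⟨ Q-a F ⟩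
        aUp F + aDiag F + aLow F    ≡⟨ +-comm _ (aLow F) ⟩
        aLow F + (aUp F + aDiag F)  ≡⟨ cong (_+ (aUp F + aDiag F)) aLowF≡xUpF ⟩
        xUp F + (aUp F + aDiag F)   ∎)

    -- For a = b the equation reads a (x + y) = n. The cofactor is e = x + y, and x takes the values
    -- below it.
    aDiag-eval : ∀ F (φ : ℕ → ℕ → ℕ → ℤ) → (∀ a x y → F a a x y ≡ φ a (x ℕ.+ y) x) →
      aDiag F ≡ D n n (λ a e → ∑[ x ≤ e ℕ.∸ 1 ] φ a e x)
    aDiag-eval F φ F-φ = begin
      aDiag F
        ≡⟨ ∑-cong n (λ a → ∑²-cong n λ x y →
             term-cong (sym (ℕ.*-distribˡ-+ (suc a) (suc x) (suc y))) (F-φ _ _ _)) ⟩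
      (∑[ a ≤ n ] ∑[ x ≤ n ] ∑[ y ≤ n ] h a (x ℕ.+ y) x)
        ≡⟨ ∑-cong n (λ a → ∑-antidiagonals n (h (suc a))
             λ e x n<e → δ-> _ (m<1+n*m a n<e)) ⟩
      (∑² n λ a e → ∑[ x ≤ e ℕ.∸ 1 ] h a e x)
        ≡⟨ ∑²-cong n (λ a e → δ-∑ (suc a ℕ.* suc e) n e (φ (suc a) (suc e))) ⟩
      D n n (λ a e → ∑[ x ≤ e ℕ.∸ 1 ] φ a e x) ∎
      where
      h : ℕ → ℕ → ℕ → ℤ
      h a e x = δ (a ℕ.* e) n (φ a e x)

    -- For x = y the equation reads (a + b) x = n. Now the divisor is e = b + a, and b takes the
    -- values below it.
    xDiag-eval : ∀ F (ψ : ℕ → ℕ → ℕ → ℤ) → (∀ a b x → F a b x x ≡ ψ x (b ℕ.+ a) b) →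
      xDiag F ≡ D n n (λ e x → ∑[ b ≤ e ℕ.∸ 1 ] ψ x e b)
    xDiag-eval F ψ F-ψ = begin
      xDiag F
        ≡⟨ ∑²-cong n (λ a b → ∑-cong n λ x →
             term-cong (trans (sym (ℕ.*-distribʳ-+ (suc x) (suc a) (suc b)))
                              (cong (ℕ._* suc x) (ℕ.+-comm (suc a) (suc b))))
                       (F-ψ (suc a) (suc b) (suc x))) ⟩
      (∑[ a ≤ n ] ∑[ b ≤ n ] ∑[ x ≤ n ] h x (b ℕ.+ a) b)
        ≡⟨ ∑-cong n (λ a → ∑-swap n n λ b x → h x (b ℕ.+ suc a) b) ⟩
      (∑[ a ≤ n ] ∑[ x ≤ n ] ∑[ b ≤ n ] h x (b ℕ.+ a) b)
        ≡⟨ ∑-swap n n (λ a x → ∑[ b ≤ n ] h x (b ℕ.+ a) b) ⟩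
      (∑[ x ≤ n ] ∑[ a ≤ n ] ∑[ b ≤ n ] h x (b ℕ.+ a) b)
        ≡⟨ ∑-cong n (λ x → trans (∑-swap n n λ a b → h (suc x) (b ℕ.+ a) b)
             (∑-antidiagonals n (h (suc x))
               λ e b n<e → δ-> _ (subst (n <_) (ℕ.*-comm (suc x) e) (m<1+n*m x n<e)))) ⟩
      (∑[ x ≤ n ] ∑[ e ≤ n ] ∑[ b ≤ e ℕ.∸ 1 ] h x e b)
        ≡⟨ ∑²-cong n (λ x e → δ-∑ (suc e ℕ.* suc x) n e (ψ (suc x) (suc e))) ⟩
      (∑[ x ≤ n ] ∑[ e ≤ n ] δ (e ℕ.* x) n (∑[ b ≤ e ℕ.∸ 1 ] ψ x e b))
        ≡⟨ ∑-swap n n (λ x e → δ (e ℕ.* x) n (∑[ b ≤ e ℕ.∸ 1 ] ψ x e b)) ⟩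
      D n n (λ e x → ∑[ b ≤ e ℕ.∸ 1 ] ψ x e b) ∎
      where
      h : ℕ → ℕ → ℕ → ℤ
      h x e b = δ (e ℕ.* x) n (ψ x e b)

  -- Convolutions and divisor sums

  D-cong : ∀ n {f g : ℕ → ℕ → ℤ} → (∀ e x → f (suc e) (suc x) ≡ g (suc e) (suc x)) →
           D n n f ≡ D n n g
  D-cong n f≗g = ∑²-cong n λ e x → cong (δ (suc e ℕ.* suc x) n) (f≗g e x)

  D-+ : ∀ n (f g : ℕ → ℕ → ℤ) → D n n (λ e x → f e x + g e x) ≡ D n n f + D n n g
  D-+ n f g = trans (∑²-cong n λ e x → δ-+ (suc e ℕ.* suc x) n (f (suc e) (suc x)) (g (suc e) (suc x)))
                    (∑²-+ n (λ e x → δ (e ℕ.* x) n (f e x)) (λ e x → δ (e ℕ.* x) n (g e x)))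

  D-* : ∀ n c (f : ℕ → ℕ → ℤ) → D n n (λ e x → c * f e x) ≡ c * D n n f
  D-* n c f = trans (∑²-cong n λ e x → δ-* (suc e ℕ.* suc x) n c (f (suc e) (suc x)))
                    (∑²-*ˡ n c (λ e x → δ (e ℕ.* x) n (f e x)))

  D-extend : ∀ {N n} (f : ℕ → ℕ → ℤ) → n ≤ N → D N n f ≡ D n n f
  D-extend {N} {n} f n≤N = begin
    D N n f
      ≡⟨ ∑-cong N (λ e → ∑-extend (λ x → δ (suc e ℕ.* x) n (f (suc e) x)) n≤N
           λ x n<x → δ-> _ (m<1+n*m e n<x)) ⟩
    (∑[ e ≤ N ] ∑[ x ≤ n ] δ (e ℕ.* x) n (f e x))
      ≡⟨ ∑-extend (λ e → ∑[ x ≤ n ] δ (e ℕ.* x) n (f e x)) n≤N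
           (λ e n<e → ∑-zero n λ x → δ-> _ (subst (n <_) (ℕ.*-comm (suc x) e) (m<1+n*m x n<e))) ⟩
    D n n f ∎

  Q-cong : ∀ n {F G : ℕ → ℕ → ℕ → ℕ → ℤ} → (∀ a b x y → F a b x y ≡ G a b x y) → Q n F ≡ Q n G
  Q-cong n F≗G = ∑²-cong n λ a b → ∑²-cong n λ x y →
    cong (δ (suc a ℕ.* suc x ℕ.+ suc b ℕ.* suc y) n) (F≗G (suc a) (suc b) (suc x) (suc y))

  Q-+ : ∀ n (F G : ℕ → ℕ → ℕ → ℕ → ℤ) →
        Q n (λ a b x y → F a b x y + G a b x y) ≡ Q n F + Q n G
  Q-+ n F G = begin
    Q n (λ a b x y → F a b x y + G a b x y)
      ≡⟨ ∑²-cong n (λ a b → trans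
           (∑²-cong n λ x y → δ-+ (m (suc a) (suc b) (suc x) (suc y)) n
              (F (suc a) (suc b) (suc x) (suc y)) (G (suc a) (suc b) (suc x) (suc y)))
           (∑²-+ n (λ x y → δ (m (suc a) (suc b) x y) n (F (suc a) (suc b) x y))
                   (λ x y → δ (m (suc a) (suc b) x y) n (G (suc a) (suc b) x y)))) ⟩
    (∑² n λ a b → (∑² n λ x y → δ (m a b x y) n (F a b x y)) +
                  (∑² n λ x y → δ (m a b x y) n (G a b x y)))
      ≡⟨ ∑²-+ n (λ a b → ∑² n λ x y → δ (m a b x y) n (F a b x y))
                (λ a b → ∑² n λ x y → δ (m a b x y) n (G a b x y)) ⟩
    Q n F + Q n G ∎
    where
    m : ℕ → ℕ → ℕ → ℕ → ℕ
    m a b x y = a ℕ.* x ℕ.+ b ℕ.* y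

  Q-* : ∀ n c (F : ℕ → ℕ → ℕ → ℕ → ℤ) → Q n (λ a b x y → c * F a b x y) ≡ c * Q n F
  Q-* n c F = begin
    Q n (λ a b x y → c * F a b x y)
      ≡⟨ ∑²-cong n (λ a b → trans
           (∑²-cong n λ x y → δ-* (m (suc a) (suc b) (suc x) (suc y)) n c
              (F (suc a) (suc b) (suc x) (suc y)))
           (∑²-*ˡ n c (λ x y → δ (m (suc a) (suc b) x y) n (F (suc a) (suc b) x y)))) ⟩
    (∑² n λ a b → c * (∑² n λ x y → δ (m a b x y) n (F a b x y)))
      ≡⟨ ∑²-*ˡ n c (λ a b → ∑² n λ x y → δ (m a b x y) n (F a b x y)) ⟩
    c * Q n F ∎
    where
    m : ℕ → ℕ → ℕ → ℕ → ℕ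
    m a b x y = a ℕ.* x ℕ.+ b ℕ.* y

  Q-swap : ∀ n (F : ℕ → ℕ → ℕ → ℕ → ℤ) → Q n F ≡ Q n (λ a b x y → F b a y x)
  Q-swap n F = begin
    Q n F
      ≡⟨ ∑²-flip n (λ a b → ∑² n λ x y → δ (a ℕ.* x ℕ.+ b ℕ.* y) n (F a b x y)) ⟩
    (∑² n λ b a → ∑² n λ x y → δ (a ℕ.* x ℕ.+ b ℕ.* y) n (F a b x y))
      ≡⟨ ∑²-cong n (λ b a → trans
           (∑²-flip n λ x y → δ (suc a ℕ.* x ℕ.+ suc b ℕ.* y) n (F (suc a) (suc b) x y))
           (∑²-cong n λ y x → cong (λ k → δ k n (F (suc a) (suc b) (suc x) (suc y)))
             (ℕ.+-comm (suc a ℕ.* suc x) (suc b ℕ.* suc y)))) ⟩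
    Q n (λ a b x y → F b a y x) ∎

  -- The hypothesis on `c` covers an index `suc k` outside the range, where both sides are 0.
  ∑-δ : ∀ n k (c : ℕ → ℤ) → (∀ d → n < d → c d ≡ 0ℤ) → ∑[ d ≤ n ] δ (suc k) d (c d) ≡ c (suc k)
  ∑-δ n k c c≡0 with k ℕ.<? n
  ... | yes k<n = trans
    (∑-single n (λ d → δ (suc k) d (c d)) k<n λ d d≢k → δ-≢ _ (d≢k ∘ sym ∘ ℕ.suc-injective))
    (δ-≡ (c (suc k)) refl)
  ... | no  k≮n = trans
    (∑-zero n λ d → trans (δ-cong λ { refl → c≡0 (suc k) n<1+k }) (δ-map (suc k) (suc d) (λ _ → 0ℤ) 0ℤ refl))
    (sym (c≡0 (suc k) n<1+k))
    where n<1+k = s≤s (ℕ.≮⇒≥ k≮n)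

  δ-0 : ∀ m n → δ m n 0ℤ ≡ 0ℤ
  δ-0 m n = δ-map m n (λ _ → 0ℤ) 0ℤ refl

  conv : ℕ → (ℕ → ℤ) → (ℕ → ℤ) → ℤ
  conv n u v = ∑² n λ i j → δ (i ℕ.+ j) n (u i * v j)

  ∑²-*-∑² : ∀ n (f g : ℕ → ℕ → ℤ) → ∑² n f * ∑² n g ≡ ∑² n λ a x → ∑² n λ b y → f a x * g b y
  ∑²-*-∑² n f g = begin
    ∑² n f * ∑² n g
      ≡⟨ *-comm (∑² n f) (∑² n g) ⟩
    ∑² n g * ∑² n f
      ≡⟨ sym (∑²-*ˡ n (∑² n g) f) ⟩
    (∑² n λ a x → ∑² n g * f a x)
      ≡⟨ ∑²-cong n (λ a x → trans (*-comm (∑² n g) (f (suc a) (suc x)))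
                                  (sym (∑²-*ˡ n (f (suc a) (suc x)) g))) ⟩
    (∑² n λ a x → ∑² n λ b y → f a x * g b y) ∎

  δ-∑² : ∀ m n N (f : ℕ → ℕ → ℤ) → δ m n (∑² N f) ≡ ∑² N λ i j → δ m n (f i j)
  δ-∑² m n N f = trans (sym (δ-∑ m n N λ i → ∑ N (f i)))
                       (∑-cong N λ i → sym (δ-∑ m n N (f (suc i))))

  -- All divisor sums are first given the common range `n`, which is legitimate because i + j = n
  -- bounds i and j. Then i and j are determined by i = a x and j = b y, and `collapse` sums them
  -- away.
  conv-D : ∀ n (f g : ℕ → ℕ → ℤ) →
    conv n (λ i → D i i f) (λ j → D j j g) ≡ Q n (λ a b x y → f a x * g b y)
  conv-D n f g = begin
    conv n (λ i → D i i f) (λ j → D j j g)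
      ≡⟨ ∑²-cong n (λ i j → δ-cong λ i+j≡n → cong₂ _*_
           (sym (D-extend {n} f (subst (suc i ≤_) i+j≡n (ℕ.m≤m+n (suc i) (suc j)))))
           (sym (D-extend {n} g (subst (suc j ≤_) i+j≡n (ℕ.m≤n+m (suc j) (suc i)))))) ⟩
    conv n (λ i → D n i f) (λ j → D n j g)
      ≡⟨ ∑²-cong n (λ i j → trans
           (cong (δ (suc i ℕ.+ suc j) n) (∑²-*-∑² n (α (suc i)) (β (suc j))))
           (trans (δ-∑² (suc i ℕ.+ suc j) n n λ a x → ∑² n λ b y → α (suc i) a x * β (suc j) b y)
             (∑²-cong n λ a x →
               δ-∑² (suc i ℕ.+ suc j) n n λ b y → α (suc i) (suc a) (suc x) * β (suc j) b y))) ⟩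
    (∑² n λ i j → ∑² n λ a x → ∑² n λ b y → t i j a x b y)
      ≡⟨ ∑²-swap n (λ i j a x → ∑² n λ b y → t i j a x b y) ⟩
    (∑² n λ a x → ∑² n λ i j → ∑² n λ b y → t i j a x b y)
      ≡⟨ ∑²-cong n (λ a x → ∑²-swap n λ i j b y → t i j (suc a) (suc x) b y) ⟩
    (∑² n λ a x → ∑² n λ b y → ∑² n λ i j → t i j a x b y)
      -- `x ℕ.+ a ℕ.* suc x` is the predecessor of `suc a ℕ.* suc x`, as `collapse` expects.
      ≡⟨ ∑²-cong n (λ a x → ∑²-cong n λ b y →
           collapse (x ℕ.+ a ℕ.* suc x) (y ℕ.+ b ℕ.* suc y) (f (suc a) (suc x)) (g (suc b) (suc y))) ⟩
    (∑[ a ≤ n ] ∑[ x ≤ n ] ∑[ b ≤ n ] ∑[ y ≤ n ] δ (a ℕ.* x ℕ.+ b ℕ.* y) n (f a x * g b y))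
      ≡⟨ ∑-cong n (λ a → ∑-swap n n λ x b → ∑[ y ≤ n ] δ (suc a ℕ.* x ℕ.+ b ℕ.* y) n (f (suc a) x * g b y)) ⟩
    Q n (λ a b x y → f a x * g b y) ∎
    where
    α β : ℕ → ℕ → ℕ → ℤ
    α i a x = δ (a ℕ.* x) i (f a x)
    β j b y = δ (b ℕ.* y) j (g b y)

    t : ℕ → ℕ → ℕ → ℕ → ℕ → ℕ → ℤ
    t i j a x b y = δ (i ℕ.+ j) n (α i a x * β j b y)

    collapse : ∀ k l u v →
      (∑² n λ i j → δ (i ℕ.+ j) n (δ (suc k) i u * δ (suc l) j v)) ≡ δ (suc k ℕ.+ suc l) n (u * v)
    collapse k l u v = begin
      (∑² n λ i j → δ (i ℕ.+ j) n (δ (suc k) i u * δ (suc l) j v))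
        ≡⟨ ∑²-cong n (λ i j → reorder (suc i) (suc j)) ⟩
      (∑² n λ i j → δ (suc k) i (δ (suc l) j (δ (i ℕ.+ j) n (u * v))))
        ≡⟨ ∑-cong n (λ i → δ-∑ (suc k) (suc i) n λ j → δ (suc l) j (δ (suc i ℕ.+ j) n (u * v))) ⟩
      (∑[ i ≤ n ] δ (suc k) i (∑[ j ≤ n ] δ (suc l) j (δ (i ℕ.+ j) n (u * v))))
        ≡⟨ ∑-cong n (λ i → cong (δ (suc k) (suc i)) (∑-δ n l (λ j → δ (suc i ℕ.+ j) n (u * v))
             λ j n<j → δ-> _ (ℕ.≤-trans n<j (ℕ.m≤n+m j (suc i))))) ⟩
      (∑[ i ≤ n ] δ (suc k) i (δ (i ℕ.+ suc l) n (u * v)))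
        ≡⟨ ∑-δ n k (λ i → δ (i ℕ.+ suc l) n (u * v))
             (λ i n<i → δ-> _ (ℕ.≤-trans n<i (ℕ.m≤m+n i (suc l)))) ⟩
      δ (suc k ℕ.+ suc l) n (u * v) ∎
      where
      reorder : ∀ i j → δ (i ℕ.+ j) n (δ (suc k) i u * δ (suc l) j v) ≡
                        δ (suc k) i (δ (suc l) j (δ (i ℕ.+ j) n (u * v)))
      reorder i j = begin
        δ (i ℕ.+ j) n (δ (suc k) i u * δ (suc l) j v)
          ≡⟨ sym (δ-map (suc k) i (λ t → δ (i ℕ.+ j) n (t * δ (suc l) j v)) u (δ-0 _ _)) ⟩
        δ (suc k) i (δ (i ℕ.+ j) n (u * δ (suc l) j v))
          ≡⟨ cong (δ (suc k) i) (sym (δ-map (suc l) j (λ t → δ (i ℕ.+ j) n (u * t)) v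
               (trans (cong (δ (i ℕ.+ j) n) (*-zeroʳ u)) (δ-0 _ _)))) ⟩
        δ (suc k) i (δ (suc l) j (δ (i ℕ.+ j) n (u * v))) ∎

  sumℤ-filter : ∀ {A : Set} {P : A → Set} (P? : Decidable P) (f : A → ℤ) xs →
    sumℤ (map f (filter P? xs)) ≡ sumℤ (map (λ x → if does (P? x) then f x else 0ℤ) xs)
  sumℤ-filter P? f []       = refl
  sumℤ-filter P? f (x ∷ xs) with does (P? x)
  ... | true  = cong (_+_ (f x)) (sumℤ-filter P? f xs)
  ... | false = trans (sumℤ-filter P? f xs) (sym (+-identityˡ _))

  sumℤ-applyUpTo : ∀ (f g : ℕ → ℤ) (h : ℕ → ℕ) n → (∀ k → f (h k) ≡ g (suc k)) →
    sumℤ (map f (applyUpTo h n)) ≡ ∑ n g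
  sumℤ-applyUpTo f g h zero    f∘h≗g = refl
  sumℤ-applyUpTo f g h (suc n) f∘h≗g =
    cong₂ _+_ (f∘h≗g 0) (sumℤ-applyUpTo f (g ∘ suc) (h ∘ suc) n (f∘h≗g ∘ suc))

  -- For a divisor d exactly one x with d x = n survives. This lets `f′` refer to the cofactor,
  -- which `f` can reach only by division.
  ∑-divisors≡D : ∀ n .{{_ : NonZero n}} (f : (d : ℕ) → .{{NonZero d}} → ℤ) (f′ : ℕ → ℕ → ℤ) →
    (∀ d x → suc d ℕ.* suc x ≡ n → f (suc d) ≡ f′ (suc d) (suc x)) →
    ∑-divisors n f ≡ D n n f′
  ∑-divisors≡D n f f′ f≡f′ =
    trans (sumℤ-filter (λ k → suc k ∣? n) (λ k → f (suc k)) (upTo n))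
          (sumℤ-applyUpTo _ (λ d → ∑[ x ≤ n ] δ (d ℕ.* x) n (f′ d x)) id n λ d → term d (suc d ∣? n))
    where
    term : ∀ d (d∣n? : Dec (suc d ∣ n)) →
      (if does d∣n? then f (suc d) else 0ℤ) ≡ ∑[ x ≤ n ] δ (suc d ℕ.* x) n (f′ (suc d) x)
    term d (no ∤n) = sym (∑-zero n λ x → δ-≢ _ λ eq →
      ∤n (divides (suc x) (trans (sym eq) (ℕ.*-comm (suc d) (suc x)))))
    term d (yes (divides zero    n≡0)) = contradiction n≡0 (ℕ.≢-nonZero⁻¹ n)
    term d (yes (divides (suc q) n≡q*d)) = sym (trans
      (∑-single n (λ x → δ (suc d ℕ.* x) n (f′ (suc d) x)) q<n λ x x≢q →
        δ-≢ _ λ d*x≡n → x≢q (ℕ.suc-injective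
          (ℕ.*-cancelˡ-≡ (suc x) (suc q) (suc d) (trans d*x≡n (sym d*q≡n)))))
      (trans (δ-≡ _ d*q≡n) (sym (f≡f′ d q d*q≡n))))
      where
      d*q≡n : suc d ℕ.* suc q ≡ n
      d*q≡n = trans (ℕ.*-comm (suc d) (suc q)) (sym n≡q*d)
      q<n : suc q ≤ n
      q<n = subst (suc q ≤_) (sym n≡q*d) (ℕ.m≤m*n (suc q) (suc d))

  -- Parity

  -- An integer-valued indicator, so that parity conditions are factors of the weights and parity
  -- arguments become polynomial identities.
  odd : ℕ → ℤ
  odd zero    = 0ℤ
  odd (suc n) = 1ℤ - odd n

  even : ℕ → ℤ
  even n = 1ℤ - odd n

  odd-0-1 : ∀ n → odd n ≡ 0ℤ ⊎ odd n ≡ 1ℤ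
  odd-0-1 zero    = inj₁ refl
  odd-0-1 (suc n) with odd-0-1 n
  ... | inj₁ o≡0 = inj₂ (cong (_-_ 1ℤ) o≡0)
  ... | inj₂ o≡1 = inj₁ (cong (_-_ 1ℤ) o≡1)

  -- Exclusive or, written as a polynomial in the indicators.
  odd-+ : ∀ m n → odd (m ℕ.+ n) ≡ odd m + odd n - + 2 * odd m * odd n
  odd-+ zero    n = solve 1 (λ b → b := # 0 :+ b :- # 2 :* # 0 :* b) refl (odd n)
  odd-+ (suc m) n = trans (cong (_-_ 1ℤ) (odd-+ m n))
    (solve 2 (λ a b → # 1 :- (a :+ b :- # 2 :* a :* b) :=
                      (# 1 :- a) :+ b :- # 2 :* (# 1 :- a) :* b)
       refl (odd m) (odd n))

  odd-double : ∀ n → odd (n ℕ.+ n) ≡ 0ℤ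
  odd-double n with odd-0-1 n | odd-+ n n
  ... | inj₁ o≡0 | eq rewrite o≡0 = eq
  ... | inj₂ o≡1 | eq rewrite o≡1 = eq

  -- This and the next two facts are the compatibility conditions for the weights in
  -- `liouville-odd`. They rest on indicators being idempotent, which is no ring identity; hence the
  -- distinction of the values 0 and 1.
  odd-+*even : ∀ m n → odd (n ℕ.+ m) * even n ≡ odd m * even n
  odd-+*even m n = trans (cong (_* even n) (odd-+ n m)) (by-cases (odd m) (odd-0-1 n))
    where
    by-cases : ∀ a {b} → b ≡ 0ℤ ⊎ b ≡ 1ℤ → (b + a - + 2 * b * a) * (1ℤ - b) ≡ a * (1ℤ - b)
    by-cases a (inj₁ refl) = solve 1 (λ a → (# 0 :+ a :- # 2 :* # 0 :* a) :* # 1 := a :* # 1) refl a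
    by-cases a (inj₂ refl) = solve 1 (λ a → (# 1 :+ a :- # 2 :* # 1 :* a) :* # 0 := a :* # 0) refl a

  odd*even-+ : ∀ m n → odd m * even (m ℕ.+ n) ≡ odd m * odd n
  odd*even-+ m n = trans (cong (λ t → odd m * (1ℤ - t)) (odd-+ m n)) (by-cases (odd n) (odd-0-1 m))
    where
    by-cases : ∀ b {a} → a ≡ 0ℤ ⊎ a ≡ 1ℤ → a * (1ℤ - (a + b - + 2 * a * b)) ≡ a * b
    by-cases b (inj₁ refl) = solve 1 (λ b → # 0 :* (# 1 :- (# 0 :+ b :- # 2 :* # 0 :* b)) :=
         # 0 :* b) refl b
    by-cases b (inj₂ refl) = solve 1 (λ b → # 1 :* (# 1 :- (# 1 :+ b :- # 2 :* # 1 :* b)) :=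
         # 1 :* b) refl b

  odd*odd-+ : ∀ m n → odd m * odd (m ℕ.+ n) ≡ odd m * even n
  odd*odd-+ m n = trans (cong (odd m *_) (odd-+ m n)) (by-cases (odd n) (odd-0-1 m))
    where
    by-cases : ∀ b {a} → a ≡ 0ℤ ⊎ a ≡ 1ℤ → a * (a + b - + 2 * a * b) ≡ a * (1ℤ - b)
    by-cases b (inj₁ refl) = solve 1 (λ b → # 0 :* (# 0 :+ b :- # 2 :* # 0 :* b) :=
         # 0 :* (# 1 :- b)) refl b
    by-cases b (inj₂ refl) = solve 1 (λ b → # 1 :* (# 1 :+ b :- # 2 :* # 1 :* b) :=
         # 1 :* (# 1 :- b)) refl b

  odd*even≡0 : ∀ n → odd n * even n ≡ 0ℤ
  odd*even≡0 n with odd-0-1 n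
  ... | inj₁ o≡0 rewrite o≡0 = refl
  ... | inj₂ o≡1 rewrite o≡1 = refl

  ε : ℕ → ℤ
  ε n = -1ℤ ^ n

  ε≡2even-1 : ∀ n → ε n ≡ + 2 * even n - 1ℤ
  ε≡2even-1 zero    = refl
  ε≡2even-1 (suc n) = trans (cong (-1ℤ *_) (ε≡2even-1 n))
    (solve 1 (λ a → con -1ℤ :* (# 2 :* (# 1 :- a) :- # 1) :=
                    # 2 :* (# 1 :- (# 1 :- a)) :- # 1) refl (odd n))

  ε-+ : ∀ m n → ε (m ℕ.+ n) ≡ ε m * ε n
  ε-+ m n = ^-distribˡ-+-* -1ℤ m n

  ε*ε : ∀ n → ε n * ε n ≡ 1ℤ
  ε*ε zero    = refl
  ε*ε (suc n) = trans (solve 1 (λ e → (con -1ℤ :* e) :* (con -1ℤ :* e) :=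
       e :* e) refl (ε n)) (ε*ε n)

  -- Power sums

  -- When χ m = 1, going from m to m + 2 adds the single term f (m + 2), as χ (m + 1) = 0. So an
  -- antidifference p of c f with step two is a closed form once it fits the start. The factor χ m
  -- silences the other parity class, and the step of two calls for two base cases.
  ∑-alternating : ∀ (χ f p : ℕ → ℤ) c →
    (∀ m → χ (suc m) ≡ 1ℤ - χ m) → (∀ m → χ m ≡ 0ℤ ⊎ χ m ≡ 1ℤ) →
    0ℤ ≡ χ 0 * p 1 → c * (χ 1 * (χ 1 * f 1)) ≡ χ 1 * p 2 →
    (∀ m → p (3 ℕ.+ m) ≡ p (1 ℕ.+ m) + c * f (2 ℕ.+ m)) →
    ∀ m → c * (χ m * ∑[ b ≤ m ] (χ b * f b)) ≡ χ m * p (suc m)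
  ∑-alternating χ f p c χ-suc χ-0-1 base₀ base₁ step = go
    where
    go : ∀ m → c * (χ m * ∑[ b ≤ m ] (χ b * f b)) ≡ χ m * p (suc m)
    go zero          = trans (solve 2 (λ c x → c :* (x :* # 0) := # 0) refl c (χ 0)) base₀
    go (suc zero)    = trans (cong (λ t → c * (χ 1 * t)) (+-identityʳ (χ 1 * f 1))) base₁
    go (suc (suc m)) = begin
      c * (χ (2 ℕ.+ m) * ∑ (2 ℕ.+ m) g)
        ≡⟨ cong₂ (λ s t → c * (s * t)) χ-period ∑-step ⟩
      c * (χ m * (∑ m g + (1ℤ - χ m) * f (1 ℕ.+ m) + χ m * f (2 ℕ.+ m)))
        ≡⟨ by-cases (∑ m g) (p (1 ℕ.+ m)) (f (1 ℕ.+ m)) (f (2 ℕ.+ m)) (χ-0-1 m) (go m) ⟩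
      χ m * (p (1 ℕ.+ m) + c * f (2 ℕ.+ m))
        ≡⟨ sym (cong₂ _*_ χ-period (step m)) ⟩
      χ (2 ℕ.+ m) * p (3 ℕ.+ m) ∎
      where
      g : ℕ → ℤ
      g b = χ b * f b
      χ-period : χ (2 ℕ.+ m) ≡ χ m
      χ-period = trans (χ-suc (1 ℕ.+ m)) (trans (cong (_-_ 1ℤ) (χ-suc m))
        (solve 1 (λ a → # 1 :- (# 1 :- a) := a) refl (χ m)))
      ∑-step : ∑ (2 ℕ.+ m) g ≡ ∑ m g + (1ℤ - χ m) * f (1 ℕ.+ m) + χ m * f (2 ℕ.+ m)
      ∑-step = begin
        ∑ (2 ℕ.+ m) g
          ≡⟨ ∑-last (1 ℕ.+ m) g ⟩
        ∑ (1 ℕ.+ m) g + g (2 ℕ.+ m)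
          ≡⟨ cong (_+ g (2 ℕ.+ m)) (∑-last m g) ⟩
        ∑ m g + g (1 ℕ.+ m) + g (2 ℕ.+ m)
          ≡⟨ cong₂ (λ s t → ∑ m g + s * f (1 ℕ.+ m) + t * f (2 ℕ.+ m)) (χ-suc m) χ-period ⟩
        ∑ m g + (1ℤ - χ m) * f (1 ℕ.+ m) + χ m * f (2 ℕ.+ m) ∎
      by-cases : ∀ s p q r {a} → a ≡ 0ℤ ⊎ a ≡ 1ℤ → c * (a * s) ≡ a * p →
        c * (a * (s + (1ℤ - a) * q + a * r)) ≡ a * (p + c * r)
      by-cases s p q r (inj₁ refl) _  =
        solve 5 (λ c s p q r → c :* (# 0 :* (s :+ # 1 :* q :+ # 0 :* r)) := # 0 :* (p :+ c :* r))
          refl c s p q r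
      by-cases s p q r (inj₂ refl) ih = begin
        c * (1ℤ * (s + 0ℤ * q + 1ℤ * r))
          ≡⟨ solve 4 (λ c s q r → c :* (# 1 :* (s :+ # 0 :* q :+ # 1 :* r)) :=
                                  c :* (# 1 :* s) :+ c :* r) refl c s q r ⟩
        c * (1ℤ * s) + c * r  ≡⟨ cong (_+ c * r) ih ⟩
        1ℤ * p + c * r        ≡⟨ solve 2 (λ p t → # 1 :* p :+ t := # 1 :* (p :+ t)) refl p (c * r) ⟩
        1ℤ * (p + c * r)      ∎

  even-0-1 : ∀ n → even n ≡ 0ℤ ⊎ even n ≡ 1ℤ
  even-0-1 = odd-0-1 ∘ suc

  -- Written in e = m + 1, since the diagonal sums run over b < e; `even m` then says that e is odd.
  -- The polynomial e³ - e vanishes at 1, and its values at t + 1 and t - 1 differ by 6 t².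
  ∑-even² : ∀ m → + 6 * (even m * ∑[ b ≤ m ] (even b * (+ b) ^ 2)) ≡
                  even m * ((+ suc m) ^ 3 - + suc m)
  ∑-even² = ∑-alternating even (λ b → (+ b) ^ 2) (λ e → (+ e) ^ 3 - + e) (+ 6)
    (λ _ → refl) even-0-1 refl refl
    (λ m → solve 1 (λ m → (# 3 :+ m) :^ 3 :- (# 3 :+ m) :=
                          (# 1 :+ m) :^ 3 :- (# 1 :+ m) :+ # 6 :* (# 2 :+ m) :^ 2)
             refl (+ m))

  -- The coefficients - 10 and 7 are forced by the requirement that the values at t + 1 and t - 1
  -- differ by 30 t⁴. The polynomial vanishes at e = 1, matching the empty sum.
  ∑-even⁴ : ∀ m → + 30 * (even m * ∑[ b ≤ m ] (even b * (+ b) ^ 4)) ≡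
                  even m * (+ 3 * (+ suc m) ^ 5 - + 10 * (+ suc m) ^ 3 + + 7 * + suc m)
  ∑-even⁴ = ∑-alternating even (λ b → (+ b) ^ 4) (λ e → + 3 * (+ e) ^ 5 - + 10 * (+ e) ^ 3 + + 7 * + e) (+ 30)
    (λ _ → refl) even-0-1 refl refl
    (λ m → solve 1 (λ m → # 3 :* (# 3 :+ m) :^ 5 :- # 10 :* (# 3 :+ m) :^ 3 :+ # 7 :* (# 3 :+ m) :=
                          # 3 :* (# 1 :+ m) :^ 5 :- # 10 :* (# 1 :+ m) :^ 3 :+ # 7 :* (# 1 :+ m)
                            :+ # 30 :* (# 2 :+ m) :^ 4)
             refl (+ m))

  ∑-odd : ∀ m → + 2 * (odd m * ∑ m odd) ≡ odd m * + suc m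
  ∑-odd m = trans (cong (λ t → + 2 * (odd m * t)) (∑-cong m λ b → sym (*-identityʳ (odd (suc b)))))
    (∑-alternating odd (λ _ → 1ℤ) +_ (+ 2) (λ _ → refl) odd-0-1 refl refl
       (λ m → solve 1 (λ m → # 3 :+ m := # 1 :+ m :+ # 2 :* # 1) refl (+ m)) m)

  ∑-ε : ∀ m → ∑ m ε ≡ - odd m
  ∑-ε zero    = refl
  ∑-ε (suc m) = begin
    ∑ (suc m) ε            ≡⟨ ∑-last m ε ⟩
    ∑ m ε + ε (suc m)      ≡⟨ cong₂ _+_ (∑-ε m) (ε≡2even-1 (suc m)) ⟩
    - odd m + (+ 2 * (1ℤ - (1ℤ - odd m)) - 1ℤ)
      ≡⟨ solve 1 (λ a → :- a :+ (# 2 :* (# 1 :- (# 1 :- a)) :- # 1) := :- (# 1 :- a)) refl (odd m) ⟩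
    - odd (suc m)          ∎

  ∑-const : ∀ m c → ∑ m (λ _ → c) ≡ + m * c
  ∑-const zero    c = refl
  ∑-const (suc m) c = trans (cong (_+_ c) (∑-const m c))
    (solve 2 (λ m c → c :+ m :* c := (# 1 :+ m) :* c) refl (+ m) c)

  -- Faulhaber's formula for fourth powers, again in e = m + 1 because the sums stop at e - 1.
  ∑⁴-closed : ∀ m → + 30 * ∑[ b ≤ m ] ((+ b) ^ 4) ≡
    + 6 * (+ suc m) ^ 5 - + 15 * (+ suc m) ^ 4 + + 10 * (+ suc m) ^ 3 - + suc m
  ∑⁴-closed zero    = refl
  ∑⁴-closed (suc m) = begin
    + 30 * ∑ (suc m) (λ b → (+ b) ^ 4)
      ≡⟨ cong (+ 30 *_) (∑-last m (λ b → (+ b) ^ 4)) ⟩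
    + 30 * (∑ m (λ b → (+ b) ^ 4) + (+ suc m) ^ 4)
      ≡⟨ *-distribˡ-+ (+ 30) (∑ m (λ b → (+ b) ^ 4)) ((+ suc m) ^ 4) ⟩
    + 30 * ∑ m (λ b → (+ b) ^ 4) + + 30 * (+ suc m) ^ 4
      ≡⟨ cong (_+ + 30 * (+ suc m) ^ 4) (∑⁴-closed m) ⟩
    + 6 * (+ suc m) ^ 5 - + 15 * (+ suc m) ^ 4 + + 10 * (+ suc m) ^ 3 - + suc m + + 30 * (+ suc m) ^ 4
      ≡⟨ solve 1 (λ e → # 6 :* e :^ 5 :- # 15 :* e :^ 4 :+ # 10 :* e :^ 3 :- e :+ # 30 :* e :^ 4 :=
           # 6 :* (# 1 :+ e) :^ 5 :- # 15 :* (# 1 :+ e) :^ 4 :+ # 10 :* (# 1 :+ e) :^ 3 :- (# 1 :+ e))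
           refl (+ suc m) ⟩
    + 6 * (+ suc (suc m)) ^ 5 - + 15 * (+ suc (suc m)) ^ 4 + + 10 * (+ suc (suc m)) ^ 3 - + suc (suc m) ∎

  -- Divisors and cofactors of a given parity

  ∑-evens : ∀ n (h : ℕ → ℤ) → (∀ d → n < d → h d ≡ 0ℤ) →
    ∑[ x ≤ n ] (even x * h x) ≡ ∑[ x ≤ n ] h (x ℕ.+ x)
  ∑-evens n h h≡0 = begin
    ∑[ x ≤ n ] (even x * h x)
      -- Doubling the range adds only zeros and makes it a union of pairs 2 x - 1, 2 x, of which the
      -- even member survives.
      ≡⟨ sym (∑-extend (λ x → even x * h x) (ℕ.m≤m+n n n)
           λ d n<d → trans (cong (even d *_) (h≡0 d n<d)) (*-zeroʳ (even d))) ⟩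
    ∑[ x ≤ n ℕ.+ n ] (even x * h x)
      ≡⟨ ∑-double n (λ x → even x * h x) ⟩
    ∑[ x ≤ n ] (even (x ℕ.+ x ℕ.∸ 1) * h (x ℕ.+ x ℕ.∸ 1) + even (x ℕ.+ x) * h (x ℕ.+ x))
      ≡⟨ ∑-cong n (λ x → drop-odd (odd (x ℕ.+ suc x)) (odd-double (suc x))
           (h (x ℕ.+ suc x)) (h (suc x ℕ.+ suc x))) ⟩
    ∑[ x ≤ n ] h (x ℕ.+ x) ∎
    where
    drop-odd : ∀ a → 1ℤ - a ≡ 0ℤ → ∀ i j → (1ℤ - a) * i + (1ℤ - (1ℤ - a)) * j ≡ j
    drop-odd a eq i j = trans (cong (λ t → t * i + (1ℤ - t) * j) eq)
      (solve 2 (λ i j → # 0 :* i :+ (# 1 :- # 0) :* j := j) refl i j)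

  -- A factor 2 moves from the cofactor to the divisor: e (x + x) = (e + e) x.
  D-evens : ∀ n (f : ℕ → ℤ) → D n n (λ e x → even x * f (e ℕ.+ e)) ≡ D n n (λ e x → even e * f e)
  D-evens n f = begin
    D n n (λ e x → even x * f (e ℕ.+ e))
      ≡⟨ ∑-cong n (λ e → trans
           (∑-cong n λ x → δ-* (suc e ℕ.* suc x) n (even (suc x)) (f (suc e ℕ.+ suc e)))
           (∑-evens n (λ x → δ (suc e ℕ.* x) n (f (suc e ℕ.+ suc e))) λ x n<x → δ-> _ (m<1+n*m e n<x))) ⟩
    (∑[ e ≤ n ] ∑[ x ≤ n ] δ (e ℕ.* (x ℕ.+ x)) n (f (e ℕ.+ e)))
      ≡⟨ ∑²-cong n (λ e x → cong (λ k → δ k n (f (suc e ℕ.+ suc e)))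
           (trans (ℕ.*-distribˡ-+ (suc e) (suc x) (suc x)) (sym (ℕ.*-distribʳ-+ (suc x) (suc e) (suc e))))) ⟩
    (∑[ e ≤ n ] ∑[ x ≤ n ] δ ((e ℕ.+ e) ℕ.* x) n (f (e ℕ.+ e)))
      ≡⟨ ∑-swap n n (λ e x → δ ((e ℕ.+ e) ℕ.* x) n (f (e ℕ.+ e))) ⟩
    (∑[ x ≤ n ] ∑[ e ≤ n ] δ ((e ℕ.+ e) ℕ.* x) n (f (e ℕ.+ e)))
      ≡⟨ ∑-cong n (λ x → sym (trans
           (∑-cong n λ e → δ-* (suc e ℕ.* suc x) n (even (suc e)) (f (suc e)))
           (∑-evens n (λ e → δ (e ℕ.* suc x) n (f e)) λ e n<e →
             δ-> _ (subst (n <_) (ℕ.*-comm (suc x) e) (m<1+n*m x n<e))))) ⟩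
    (∑[ x ≤ n ] ∑[ e ≤ n ] δ (e ℕ.* x) n (even e * f e))
      ≡⟨ ∑-swap n n (λ x e → δ (e ℕ.* x) n (even e * f e)) ⟩
    D n n (λ e x → even e * f e) ∎

  -- Signs on the cofactor, as in X, are traded for parities of the divisor, as in O and V.
  O V X : ℕ → ℕ → ℤ
  O k n = D n n λ e x → odd e * (+ e) ^ k
  V k n = D n n λ e x → even e * (+ e) ^ k
  X k n = D n n λ e x → ε x * (+ e) ^ k

  [m+m]^k : ∀ m k → (+ (m ℕ.+ m)) ^ k ≡ (+ 2) ^ k * (+ m) ^ k
  [m+m]^k m zero    = refl
  [m+m]^k m (suc k) = trans (cong (+ (m ℕ.+ m) *_) ([m+m]^k m k))
    (solve 3 (λ m p q → (m :+ m) :* (p :* q) :=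
         (# 2 :* p) :* (m :* q)) refl (+ m) ((+ 2) ^ k) ((+ m) ^ k))

  D-all : ∀ k n → D n n (λ e x → (+ e) ^ k) ≡ O k n + V k n
  D-all k n = begin
    D n n (λ e x → (+ e) ^ k)
      ≡⟨ D-cong n (λ e x → solve 2 (λ o p → p :=
           o :* p :+ (# 1 :- o) :* p) refl (odd (suc e)) ((+ suc e) ^ k)) ⟩
    D n n (λ e x → odd e * (+ e) ^ k + even e * (+ e) ^ k)
      ≡⟨ D-+ n (λ e x → odd e * (+ e) ^ k) (λ e x → even e * (+ e) ^ k) ⟩
    O k n + V k n ∎

  D-even-cofactor : ∀ k n → + 2 * D n n (λ e x → even x * (+ e) ^ k) ≡ X k n + (O k n + V k n)
  D-even-cofactor k n = begin
    + 2 * D n n (λ e x → even x * (+ e) ^ k)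
      ≡⟨ sym (D-* n (+ 2) λ e x → even x * (+ e) ^ k) ⟩
    D n n (λ e x → + 2 * (even x * (+ e) ^ k))
      ≡⟨ D-cong n (λ e x → trans
           (solve 2 (λ v p → # 2 :* (v :* p) :=
                (# 2 :* v :- # 1) :* p :+ p) refl (even (suc x)) ((+ suc e) ^ k))
           (cong (λ t → t * (+ suc e) ^ k + (+ suc e) ^ k) (sym (ε≡2even-1 (suc x))))) ⟩
    D n n (λ e x → ε x * (+ e) ^ k + (+ e) ^ k)
      ≡⟨ D-+ n (λ e x → ε x * (+ e) ^ k) (λ e x → (+ e) ^ k) ⟩
    X k n + D n n (λ e x → (+ e) ^ k)
      ≡⟨ cong (_+_ (X k n)) (D-all k n) ⟩
    X k n + (O k n + V k n) ∎

  -- Pulled under the sum, 2^k turns e^k into (2 e)^k, so `D-evens` converts the even cofactors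
  -- counted on the left into even divisors. The relations between `X`, `O` and `V` below are
  -- instances.
  2^k*X : ∀ k n → (+ 2) ^ k * (X k n + (O k n + V k n)) ≡ + 2 * V k n
  2^k*X k n = begin
    (+ 2) ^ k * (X k n + (O k n + V k n))
      ≡⟨ cong ((+ 2) ^ k *_) (sym (D-even-cofactor k n)) ⟩
    (+ 2) ^ k * (+ 2 * D n n (λ e x → even x * (+ e) ^ k))
      ≡⟨ solve 2 (λ c d → c :* (# 2 :* d) := # 2 :* (c :* d)) refl ((+ 2) ^ k) _ ⟩
    + 2 * ((+ 2) ^ k * D n n (λ e x → even x * (+ e) ^ k))
      ≡⟨ cong (+ 2 *_) (sym (D-* n ((+ 2) ^ k) λ e x → even x * (+ e) ^ k)) ⟩
    + 2 * D n n (λ e x → (+ 2) ^ k * (even x * (+ e) ^ k))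
      ≡⟨ cong (+ 2 *_) (D-cong n λ e x → trans
           (solve 3 (λ c v p → c :* (v :* p) :=
                v :* (c :* p)) refl ((+ 2) ^ k) (even (suc x)) ((+ suc e) ^ k))
           (cong (even (suc x) *_) (sym ([m+m]^k (suc e) k)))) ⟩
    + 2 * D n n (λ e x → even x * (+ (e ℕ.+ e)) ^ k)
      ≡⟨ cong (+ 2 *_) (D-evens n (λ e → (+ e) ^ k)) ⟩
    + 2 * V k n ∎

  -- For k = 1 the powers of 2 on both sides agree and the even divisors cancel. This is the
  -- equality of the two expressions for σ̂.
  X1 : ∀ n → X 1 n ≡ - O 1 n
  X1 n = *-cancelˡ-≡ (+ 2) _ _ (begin
    + 2 * X 1 n
      ≡⟨ solve 3 (λ x o v → # 2 :* x :=
           # 2 :* (x :+ (o :+ v)) :- # 2 :* (o :+ v)) refl (X 1 n) (O 1 n) (V 1 n) ⟩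
    + 2 * (X 1 n + (O 1 n + V 1 n)) - + 2 * (O 1 n + V 1 n)
      ≡⟨ cong (_- + 2 * (O 1 n + V 1 n)) (2^k*X 1 n) ⟩
    + 2 * V 1 n - + 2 * (O 1 n + V 1 n)
      ≡⟨ solve 2 (λ o v → # 2 :* v :- # 2 :* (o :+ v) := # 2 :* (:- o)) refl (O 1 n) (V 1 n) ⟩
    + 2 * - O 1 n ∎)

  -- The general pattern is 2^(k-1) X k = - (2^(k-1) O k + (2^(k-1) - 1) V k), here with k = 3 and
  -- next with k = 5.
  4*X3 : ∀ n → + 4 * X 3 n ≡ - (+ 4 * O 3 n + + 3 * V 3 n)
  4*X3 n = *-cancelˡ-≡ (+ 2) _ _ (begin
    + 2 * (+ 4 * X 3 n)
      ≡⟨ solve 3 (λ x o v → # 2 :* (# 4 :* x) :=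
           # 8 :* (x :+ (o :+ v)) :- # 8 :* (o :+ v)) refl (X 3 n) (O 3 n) (V 3 n) ⟩
    + 8 * (X 3 n + (O 3 n + V 3 n)) - + 8 * (O 3 n + V 3 n)
      ≡⟨ cong (_- + 8 * (O 3 n + V 3 n)) (2^k*X 3 n) ⟩
    + 2 * V 3 n - + 8 * (O 3 n + V 3 n)
      ≡⟨ solve 2 (λ o v → # 2 :* v :- # 8 :* (o :+ v) :=
           # 2 :* (:- (# 4 :* o :+ # 3 :* v))) refl (O 3 n) (V 3 n) ⟩
    + 2 * - (+ 4 * O 3 n + + 3 * V 3 n) ∎)

  16*X5 : ∀ n → + 16 * X 5 n ≡ - (+ 16 * O 5 n + + 15 * V 5 n)
  16*X5 n = *-cancelˡ-≡ (+ 2) _ _ (begin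
    + 2 * (+ 16 * X 5 n)
      ≡⟨ solve 3 (λ x o v → # 2 :* (# 16 :* x) :=
           # 32 :* (x :+ (o :+ v)) :- # 32 :* (o :+ v)) refl (X 5 n) (O 5 n) (V 5 n) ⟩
    + 32 * (X 5 n + (O 5 n + V 5 n)) - + 32 * (O 5 n + V 5 n)
      ≡⟨ cong (_- + 32 * (O 5 n + V 5 n)) (2^k*X 5 n) ⟩
    + 2 * V 5 n - + 32 * (O 5 n + V 5 n)
      ≡⟨ solve 2 (λ o v → # 2 :* v :- # 32 :* (o :+ v) :=
           # 2 :* (:- (# 16 :* o :+ # 15 :* v))) refl (O 5 n) (V 5 n) ⟩
    + 2 * - (+ 16 * O 5 n + + 15 * V 5 n) ∎)

  -- The two families of weights

  -- In the applications `p` is the second or the fourth power. Evenness makes p (b - a) symmetric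
  -- in a and b, and p 0 = 0 removes it from the diagonal a = b.
  module Specialisations (p : ℤ → ℤ) (p-even : ∀ i → p (- i) ≡ p i) (p-0 : p 0ℤ ≡ 0ℤ) (n : ℕ) where
    open Trichotomy n

    private
      gap : ℕ → ℕ → ℤ
      gap a b = p (+ b - + a)

      tot : ℕ → ℕ → ℤ
      tot a b = p (+ a + + b)

      gap-sym : ∀ a b → gap b a ≡ gap a b
      gap-sym a b = trans (cong p (solve 2 (λ a b → a :- b :=
           :- (b :- a)) refl (+ a) (+ b))) (p-even _)

      gap-+ : ∀ a b → gap a (a ℕ.+ b) ≡ p (+ b)
      gap-+ a b = cong p (solve 2 (λ a b → (a :+ b) :- a := b) refl (+ a) (+ b))

      gap-≡0 : ∀ a → gap a a ≡ 0ℤ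
      gap-≡0 a = trans (cong p (i≡j⇒i-j≡0 {+ a} refl)) p-0

      tot-sym : ∀ a b → tot b a ≡ tot a b
      tot-sym a b = cong p (+-comm (+ b) (+ a))

      D-∑0 : (f : ℕ → ℕ → ℕ → ℤ) → (∀ a e x → f a e x ≡ 0ℤ) → D n n (λ a e → ∑[ x ≤ e ℕ.∸ 1 ] f a e x) ≡ 0ℤ
      D-∑0 f f≡0 = ∑²-zero n λ a e → trans
        (cong (δ (suc a ℕ.* suc e) n) (∑-zero e λ x → f≡0 (suc a) (suc e) (suc x)))
        (δ-0 _ n)

      Q-minus : ∀ F G → Q n (λ a b x y → F a b x y - G a b x y) ≡ Q n F - Q n G
      Q-minus F G = begin
        Q n (λ a b x y → F a b x y - G a b x y)
          ≡⟨ Q-cong n (λ a b x y → solve 2 (λ f g → f :- g :=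
               f :+ con -1ℤ :* g) refl (F a b x y) (G a b x y)) ⟩
        Q n (λ a b x y → F a b x y + -1ℤ * G a b x y)
          ≡⟨ Q-+ n F (λ a b x y → -1ℤ * G a b x y) ⟩
        Q n F + Q n (λ a b x y → -1ℤ * G a b x y)
          ≡⟨ cong (_+_ (Q n F)) (Q-* n -1ℤ G) ⟩
        Q n F + -1ℤ * Q n G
          ≡⟨ solve 2 (λ f g → f :+ con -1ℤ :* g := f :- g) refl (Q n F) (Q n G) ⟩
        Q n F - Q n G ∎

    -- The invariant weight is odd a · even b · p b, as adding an even b to a keeps the parity of a.
    -- For odd a, b is even exactly when a + b is odd; this links it to p (b - a) and p (a + b) over
    -- odd a and b. The diagonals a = b of `F` and `G` vanish, so only those with x = y, where e = a
    -- + b, are left.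
    liouville-odd :
      Q n (λ a b x y → odd a * odd b * (p (+ b - + a) - p (+ a + + b))) ≡
        - (+ 2 * D n n (λ e x → ∑[ b ≤ e ℕ.∸ 1 ] (odd e * even b * p (+ b)))
           + D n n (λ e x → ∑[ b ≤ e ℕ.∸ 1 ] (even e * odd b * p (+ e))))
    liouville-odd = begin
      Q n (λ a b x y → odd a * odd b * (gap a b - tot a b))
        ≡⟨ Q-cong n (λ a b x y → solve 3 (λ o g t → o :* (g :- t) :=
             o :* g :- o :* t) refl (odd a * odd b) (gap a b) (tot a b)) ⟩
      Q n (λ a b x y → G a b x y - H a b x y)
        ≡⟨ Q-minus G H ⟩
      Q n G - Q n H
        ≡⟨ liouville F G H
             (λ a b _ _ → cong₂ _*_ (*-comm (odd b) (odd a)) (gap-sym a b))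
             (λ a b _ _ → cong₂ _*_ (*-comm (odd b) (odd a)) (tot-sym a b))
             (λ a b _ _ → cong (_* p (+ b)) (odd-+*even a b))
             (λ a b _ _ → cong₂ _*_ (odd*odd-+ a b) (gap-+ a b))
             (λ a b _ _ → cong (_* tot a b) (sym (odd*even-+ a b))) ⟩
      + 2 * (aDiag F - xDiag F) + aDiag G - xDiag H
        ≡⟨ cong₂ (λ s t → + 2 * (s - xDiag F) + t - xDiag H) aF aG ⟩
      + 2 * (0ℤ - xDiag F) + 0ℤ - xDiag H
        ≡⟨ cong₂ (λ s t → + 2 * (0ℤ - s) + 0ℤ - t) xF xH ⟩
      + 2 * (0ℤ - S) + 0ℤ - T
        ≡⟨ solve 2 (λ s t → # 2 :* (# 0 :- s) :+ # 0 :- t := :- (# 2 :* s :+ t)) refl S T ⟩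
      - (+ 2 * S + T) ∎
      where
      F G H : ℕ → ℕ → ℕ → ℕ → ℤ
      F a b _ _ = odd a * even b * p (+ b)
      G a b _ _ = odd a * odd b * gap a b
      H a b _ _ = odd a * odd b * tot a b
      S T : ℤ
      S = D n n (λ e x → ∑[ b ≤ e ℕ.∸ 1 ] (odd e * even b * p (+ b)))
      T = D n n (λ e x → ∑[ b ≤ e ℕ.∸ 1 ] (even e * odd b * p (+ e)))
      aF : aDiag F ≡ 0ℤ
      aF = trans (aDiag-eval F (λ a _ _ → F a a 0 0) (λ _ _ _ → refl))
                 (D-∑0 (λ a _ _ → F a a 0 0) λ a _ _ → cong (_* p (+ a)) (odd*even≡0 a))
      aG : aDiag G ≡ 0ℤ
      aG = trans (aDiag-eval G (λ a _ _ → G a a 0 0) (λ _ _ _ → refl))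
                 (D-∑0 (λ a _ _ → G a a 0 0) λ a _ _ →
                   trans (cong (odd a * odd a *_) (gap-≡0 a)) (*-zeroʳ (odd a * odd a)))
      xF : xDiag F ≡ S
      xF = xDiag-eval F (λ _ e b → odd e * even b * p (+ b))
        λ a b x → cong (_* p (+ b)) (sym (odd-+*even a b))
      xH : xDiag H ≡ T
      xH = xDiag-eval H (λ _ e b → even e * odd b * p (+ e)) λ a b x → begin
        odd a * odd b * tot a b                ≡⟨ cong₂ _*_ (*-comm (odd a) (odd b)) (tot-sym b a) ⟩
        odd b * odd a * tot b a                ≡⟨ cong (_* tot b a) (sym (odd*even-+ b a)) ⟩
        odd b * even (b ℕ.+ a) * p (+ (b ℕ.+ a))
          ≡⟨ cong (_* p (+ (b ℕ.+ a))) (*-comm (odd b) (even (b ℕ.+ a))) ⟩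
        even (b ℕ.+ a) * odd b * p (+ (b ℕ.+ a)) ∎

    -- The invariant weight is ε x · p b, which depends neither on a nor on y, so that invariance is
    -- immediate. The signs of `G` and `H` fit because ε is multiplicative with square 1. In
    -- contrast to `liouville-odd`, the diagonal a = b of `F` survives, which makes three divisor
    -- sums.
    liouville-ε :
      Q n (λ a b x y → ε x * ε y * (p (+ b - + a) - p (+ a + + b))) ≡
        + 2 * (D n n (λ a e → ∑[ x ≤ e ℕ.∸ 1 ] (p (+ a) * ε x))
               - D n n (λ e x → ∑[ b ≤ e ℕ.∸ 1 ] (ε x * p (+ b))))
          - D n n (λ e x → ∑[ b ≤ e ℕ.∸ 1 ] p (+ e))
    liouville-ε = begin
      Q n (λ a b x y → ε x * ε y * (gap a b - tot a b))
        ≡⟨ Q-cong n (λ a b x y → solve 3 (λ o g t → o :* (g :- t) :=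
             o :* g :- o :* t) refl (ε x * ε y) (gap a b) (tot a b)) ⟩
      Q n (λ a b x y → G a b x y - H a b x y)
        ≡⟨ Q-minus G H ⟩
      Q n G - Q n H
        ≡⟨ liouville F G H
             (λ a b x y → cong₂ _*_ (*-comm (ε y) (ε x)) (gap-sym a b))
             (λ a b x y → cong₂ _*_ (*-comm (ε y) (ε x)) (tot-sym a b))
             (λ a b x y → refl)
             (λ a b x y → cong₂ _*_ (sym (ε-shift x y)) (gap-+ a b))
             (λ a b x y → cong (_* tot a b) (ε-cancel x y)) ⟩
      + 2 * (aDiag F - xDiag F) + aDiag G - xDiag H
        ≡⟨ cong₂ (λ s t → + 2 * (s - xDiag F) + t - xDiag H) aF aG ⟩
      + 2 * (R - xDiag F) + 0ℤ - xDiag H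
        ≡⟨ cong₂ (λ s t → + 2 * (R - s) + 0ℤ - t) xF xH ⟩
      + 2 * (R - S) + 0ℤ - T
        ≡⟨ cong (_- T) (+-identityʳ (+ 2 * (R - S))) ⟩
      + 2 * (R - S) - T ∎
      where
      F G H : ℕ → ℕ → ℕ → ℕ → ℤ
      F a b x _ = ε x * p (+ b)
      G a b x y = ε x * ε y * gap a b
      H a b x y = ε x * ε y * tot a b
      R S T : ℤ
      R = D n n (λ a e → ∑[ x ≤ e ℕ.∸ 1 ] (p (+ a) * ε x))
      S = D n n (λ e x → ∑[ b ≤ e ℕ.∸ 1 ] (ε x * p (+ b)))
      T = D n n (λ e x → ∑[ b ≤ e ℕ.∸ 1 ] p (+ e))
      ε-shift : ∀ x y → ε (y ℕ.+ x) ≡ ε x * ε y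
      ε-shift x y = trans (ε-+ y x) (*-comm (ε y) (ε x))
      ε-cancel : ∀ x y → ε (y ℕ.+ x) * ε y ≡ ε x
      ε-cancel x y = begin
        ε (y ℕ.+ x) * ε y   ≡⟨ cong (_* ε y) (ε-shift x y) ⟩
        ε x * ε y * ε y     ≡⟨ *-assoc (ε x) (ε y) (ε y) ⟩
        ε x * (ε y * ε y)   ≡⟨ cong (ε x *_) (ε*ε y) ⟩
        ε x * 1ℤ            ≡⟨ *-identityʳ (ε x) ⟩
        ε x                 ∎
      aF : aDiag F ≡ R
      aF = aDiag-eval F (λ a _ x → p (+ a) * ε x) (λ a x y → *-comm (ε x) (p (+ a)))
      aG : aDiag G ≡ 0ℤ
      aG = begin
        aDiag G
          ≡⟨ ∑-cong n (λ a → ∑²-zero n λ x y → trans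
               (cong (δ (suc a ℕ.* suc x ℕ.+ suc a ℕ.* suc y) n)
                 (trans (cong (ε (suc x) * ε (suc y) *_) (gap-≡0 (suc a))) (*-zeroʳ (ε (suc x) * ε (suc y)))))
               (δ-0 _ n)) ⟩
        ∑ n (λ _ → 0ℤ)
          ≡⟨ ∑-zero n (λ _ → refl) ⟩
        0ℤ ∎
      xF : xDiag F ≡ S
      xF = xDiag-eval F (λ x _ b → ε x * p (+ b)) (λ _ _ _ → refl)
      xH : xDiag H ≡ T
      xH = xDiag-eval H (λ _ e _ → p (+ e)) λ a b x → begin
        ε x * ε x * tot a b  ≡⟨ cong (_* tot a b) (ε*ε x) ⟩
        1ℤ * tot a b         ≡⟨ *-identityˡ (tot a b) ⟩
        tot a b              ≡⟨ tot-sym b a ⟩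
        tot b a              ∎

  -- Evaluation of the diagonal sums and of the convolutions

  D-linear : ∀ n c d (f g : ℕ → ℕ → ℤ) →
    D n n (λ e x → c * f e x + d * g e x) ≡ c * D n n f + d * D n n g
  D-linear n c d f g = trans (D-+ n (λ e x → c * f e x) (λ e x → d * g e x))
                             (cong₂ _+_ (D-* n c f) (D-* n d g))

  -- An even e has e / 2 odd numbers below it, which raises the exponent by one.
  D-∑-even-const : ∀ n k → + 2 * D n n (λ e x → ∑[ b ≤ e ℕ.∸ 1 ] (even e * odd b * (+ e) ^ k)) ≡ V (suc k) n
  D-∑-even-const n k = begin
    + 2 * D n n (λ e x → ∑[ b ≤ e ℕ.∸ 1 ] (even e * odd b * (+ e) ^ k))
      ≡⟨ sym (D-* n (+ 2) λ e x → ∑[ b ≤ e ℕ.∸ 1 ] (even e * odd b * (+ e) ^ k)) ⟩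
    D n n (λ e x → + 2 * ∑[ b ≤ e ℕ.∸ 1 ] (even e * odd b * (+ e) ^ k))
      ≡⟨ D-cong n (λ m x → inner m) ⟩
    V (suc k) n ∎
    where
    inner : ∀ m → + 2 * ∑[ b ≤ m ] (even (suc m) * odd b * (+ suc m) ^ k) ≡ even (suc m) * (+ suc m) ^ suc k
    inner m = begin
      + 2 * ∑[ b ≤ m ] (even (suc m) * odd b * (+ suc m) ^ k)
        ≡⟨ cong (+ 2 *_) (∑-cong m λ b → solve 3 (λ v o p → v :* o :* p := v :* p :* o) refl
             (even (suc m)) (odd (suc b)) ((+ suc m) ^ k)) ⟩
      + 2 * ∑[ b ≤ m ] (even (suc m) * (+ suc m) ^ k * odd b)
        ≡⟨ cong (+ 2 *_) (∑-*ˡ m (even (suc m) * (+ suc m) ^ k) odd) ⟩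
      + 2 * (even (suc m) * (+ suc m) ^ k * ∑ m odd)
        ≡⟨ solve 3 (λ o p s → # 2 :* ((# 1 :- (# 1 :- o)) :* p :* s) := # 2 :* (o :* s) :* p)
             refl (odd m) ((+ suc m) ^ k) (∑ m odd) ⟩
      + 2 * (odd m * ∑ m odd) * (+ suc m) ^ k
        ≡⟨ cong (_* (+ suc m) ^ k) (∑-odd m) ⟩
      odd m * + suc m * (+ suc m) ^ k
        ≡⟨ solve 3 (λ o e p → o :* e :* p :=
             (# 1 :- (# 1 :- o)) :* (e :* p)) refl (odd m) (+ suc m) ((+ suc m) ^ k) ⟩
      even (suc m) * (+ suc m) ^ suc k ∎

  D-∑-odd-even : ∀ n c k (P : ℤ → ℤ) →
    (∀ m → c * (even m * ∑[ b ≤ m ] (even b * (+ b) ^ k)) ≡ even m * P (+ suc m)) →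
    c * D n n (λ e x → ∑[ b ≤ e ℕ.∸ 1 ] (odd e * even b * (+ b) ^ k)) ≡ D n n (λ e x → odd e * P (+ e))
  D-∑-odd-even n c k P closed = begin
    c * D n n (λ e x → ∑[ b ≤ e ℕ.∸ 1 ] (odd e * even b * (+ b) ^ k))
      ≡⟨ sym (D-* n c λ e x → ∑[ b ≤ e ℕ.∸ 1 ] (odd e * even b * (+ b) ^ k)) ⟩
    D n n (λ e x → c * ∑[ b ≤ e ℕ.∸ 1 ] (odd e * even b * (+ b) ^ k))
      -- With e = suc m, `odd e` unfolds to `even m`, the factor that `closed` expects.
      ≡⟨ D-cong n (λ m x → trans
           (cong (c *_) (trans (∑-cong m λ b → *-assoc (even m) (even (suc b)) ((+ suc b) ^ k))
                               (∑-*ˡ m (even m) (λ b → even b * (+ b) ^ k))))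
           (closed m)) ⟩
    D n n (λ e x → odd e * P (+ e)) ∎

  conv-O1-O1 : ∀ n → + 24 * conv n (O 1) (O 1) ≡ + 2 * (O 3 n - O 1 n) + + 3 * V 3 n
  conv-O1-O1 n = begin
    + 24 * conv n (O 1) (O 1)
      ≡⟨ cong (+ 24 *_) (conv-D n (λ a x → odd a * (+ a) ^ 1) (λ b y → odd b * (+ b) ^ 1)) ⟩
    + 24 * Q n (λ a b x y → odd a * (+ a) ^ 1 * (odd b * (+ b) ^ 1))
      -- The - 4 is that of (b - a)² - (a + b)² = - 4 a b, and 6 clears the denominator in
      -- `∑-even²`.
      ≡⟨ solve 1 (λ q → # 24 :* q := con (- + 6) :* (con (- + 4) :* q)) refl
           (Q n (λ a b x y → odd a * (+ a) ^ 1 * (odd b * (+ b) ^ 1))) ⟩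
    - + 6 * (- + 4 * Q n (λ a b x y → odd a * (+ a) ^ 1 * (odd b * (+ b) ^ 1)))
      ≡⟨ cong (- + 6 *_) (trans
           (sym (Q-* n (- + 4) λ a b x y → odd a * (+ a) ^ 1 * (odd b * (+ b) ^ 1)))
           (Q-cong n λ a b x y → solve 4 (λ o q a b →
              con (- + 4) :* (o :* a :^ 1 :* (q :* b :^ 1)) :=
                   o :* q :* ((b :- a) :^ 2 :- (a :+ b) :^ 2))
              refl (odd a) (odd b) (+ a) (+ b))) ⟩
    - + 6 * Q n (λ a b x y → odd a * odd b * ((+ b - + a) ^ 2 - (+ a + + b) ^ 2))
      ≡⟨ cong (- + 6 *_) liouville-odd ⟩
    - + 6 * - (+ 2 * S + T)
      ≡⟨ solve 2 (λ s t → con (- + 6) :* :- (# 2 :* s :+ t) :=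
           # 2 :* (# 6 :* s) :+ # 3 :* (# 2 :* t))
           refl S T ⟩
    + 2 * (+ 6 * S) + + 3 * (+ 2 * T)
      ≡⟨ cong₂ (λ s t → + 2 * s + + 3 * t) S-eval (D-∑-even-const n 2) ⟩
    + 2 * (O 3 n - O 1 n) + + 3 * V 3 n ∎
    where
    open Specialisations (_^ 2) (solve 1 (λ i → (:- i) :^ 2 := i :^ 2) refl) refl n
    S T : ℤ
    S = D n n (λ e x → ∑[ b ≤ e ℕ.∸ 1 ] (odd e * even b * (+ b) ^ 2))
    T = D n n (λ e x → ∑[ b ≤ e ℕ.∸ 1 ] (even e * odd b * (+ e) ^ 2))
    S-eval : + 6 * S ≡ O 3 n - O 1 n
    S-eval = begin
      + 6 * S
        ≡⟨ D-∑-odd-even n (+ 6) 2 (λ e → e ^ 3 - e) ∑-even² ⟩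
      D n n (λ e x → odd e * ((+ e) ^ 3 - + e))
        ≡⟨ D-cong n (λ e x → solve 2 (λ o e → o :* (e :^ 3 :- e) :=
             # 1 :* (o :* e :^ 3) :+ con -1ℤ :* (o :* e :^ 1))
             refl (odd (suc e)) (+ suc e)) ⟩
      D n n (λ e x → 1ℤ * (odd e * (+ e) ^ 3) + -1ℤ * (odd e * (+ e) ^ 1))
        ≡⟨ D-linear n 1ℤ -1ℤ (λ e x → odd e * (+ e) ^ 3) (λ e x → odd e * (+ e) ^ 1) ⟩
      1ℤ * O 3 n + -1ℤ * O 1 n
        ≡⟨ solve 2 (λ s t → # 1 :* s :+ con -1ℤ :* t := s :- t) refl (O 3 n) (O 1 n) ⟩
      O 3 n - O 1 n ∎

  -- (b - a)⁴ - (a + b)⁴ = - 8 (a³ b + a b³), whose two terms contribute equally by symmetry.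
  Q-quartic : ∀ n (w : ℕ → ℕ → ℤ) →
    - + 16 * Q n (λ a b x y → w a x * (+ a) ^ 1 * (w b y * (+ b) ^ 3)) ≡
      Q n (λ a b x y → w a x * w b y * ((+ b - + a) ^ 4 - (+ a + + b) ^ 4))
  Q-quartic n w = begin
    - + 16 * Q n F
      ≡⟨ solve 1 (λ q → con (- + 16) :* q := con (- + 8) :* (q :+ q)) refl (Q n F) ⟩
    - + 8 * (Q n F + Q n F)
      ≡⟨ cong (λ t → - + 8 * (Q n F + t)) (Q-swap n F) ⟩
    - + 8 * (Q n F + Q n (λ a b x y → F b a y x))
      ≡⟨ cong (- + 8 *_) (sym (Q-+ n F (λ a b x y → F b a y x))) ⟩
    - + 8 * Q n (λ a b x y → F a b x y + F b a y x)
      ≡⟨ sym (Q-* n (- + 8) (λ a b x y → F a b x y + F b a y x)) ⟩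
    Q n (λ a b x y → - + 8 * (F a b x y + F b a y x))
      ≡⟨ Q-cong n (λ a b x y → solve 4 (λ o q a b →
           con (- + 8) :* (o :* a :^ 1 :* (q :* b :^ 3) :+ q :* b :^ 1 :* (o :* a :^ 3)) :=
           o :* q :* ((b :- a) :^ 4 :- (a :+ b) :^ 4)) refl (w a x) (w b y) (+ a) (+ b)) ⟩
    Q n (λ a b x y → w a x * w b y * ((+ b - + a) ^ 4 - (+ a + + b) ^ 4)) ∎
    where
    F : ℕ → ℕ → ℕ → ℕ → ℤ
    F a b x y = w a x * (+ a) ^ 1 * (w b y * (+ b) ^ 3)

  conv-O1-O3 : ∀ n → + 480 * conv n (O 1) (O 3) ≡
    + 2 * (+ 3 * O 5 n - + 10 * O 3 n + + 7 * O 1 n) + + 15 * V 5 n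
  conv-O1-O3 n = begin
    + 480 * conv n (O 1) (O 3)
      ≡⟨ cong (+ 480 *_) (conv-D n (λ a x → odd a * (+ a) ^ 1) (λ b y → odd b * (+ b) ^ 3)) ⟩
    + 480 * q
      -- The - 16 is the factor in `Q-quartic`, and 30 clears the denominator in `∑-even⁴`.
      ≡⟨ solve 1 (λ q → # 480 :* q := con (- + 30) :* (con (- + 16) :* q)) refl q ⟩
    - + 30 * (- + 16 * q)
      ≡⟨ cong (- + 30 *_) (trans (Q-quartic n (λ a _ → odd a)) liouville-odd) ⟩
    - + 30 * - (+ 2 * S + T)
      ≡⟨ solve 2 (λ s t → con (- + 30) :* :- (# 2 :* s :+ t) :=
           # 2 :* (# 30 :* s) :+ # 15 :* (# 2 :* t))
           refl S T ⟩
    + 2 * (+ 30 * S) + + 15 * (+ 2 * T)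
      ≡⟨ cong₂ (λ s t → + 2 * s + + 15 * t) S-eval (D-∑-even-const n 4) ⟩
    + 2 * (+ 3 * O 5 n - + 10 * O 3 n + + 7 * O 1 n) + + 15 * V 5 n ∎
    where
    open Specialisations (_^ 4) (solve 1 (λ i → (:- i) :^ 4 := i :^ 4) refl) refl n
    q S T : ℤ
    q = Q n (λ a b x y → odd a * (+ a) ^ 1 * (odd b * (+ b) ^ 3))
    S = D n n (λ e x → ∑[ b ≤ e ℕ.∸ 1 ] (odd e * even b * (+ b) ^ 4))
    T = D n n (λ e x → ∑[ b ≤ e ℕ.∸ 1 ] (even e * odd b * (+ e) ^ 4))
    o : ℕ → ℕ → ℕ → ℤ
    o k e _ = odd e * (+ e) ^ k
    S-eval : + 30 * S ≡ + 3 * O 5 n - + 10 * O 3 n + + 7 * O 1 n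
    S-eval = begin
      + 30 * S
        ≡⟨ D-∑-odd-even n (+ 30) 4 (λ e → + 3 * e ^ 5 - + 10 * e ^ 3 + + 7 * e) ∑-even⁴ ⟩
      D n n (λ e x → odd e * (+ 3 * (+ e) ^ 5 - + 10 * (+ e) ^ 3 + + 7 * + e))
        ≡⟨ D-cong n (λ e x → solve 2 (λ o e →
             o :* (# 3 :* e :^ 5 :- # 10 :* e :^ 3 :+ # 7 :* e) :=
             # 1 :* (# 3 :* (o :* e :^ 5) :+ con (- + 10) :* (o :* e :^ 3)) :+ # 7 :* (o :* e :^ 1))
             refl (odd (suc e)) (+ suc e)) ⟩
      D n n (λ e x → 1ℤ * (+ 3 * o 5 e x + - + 10 * o 3 e x) + + 7 * o 1 e x)
        ≡⟨ D-linear n 1ℤ (+ 7) (λ e x → + 3 * o 5 e x + - + 10 * o 3 e x) (o 1) ⟩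
      1ℤ * D n n (λ e x → + 3 * o 5 e x + - + 10 * o 3 e x) + + 7 * O 1 n
        ≡⟨ cong (λ t → 1ℤ * t + + 7 * O 1 n) (D-linear n (+ 3) (- + 10) (o 5) (o 3)) ⟩
      1ℤ * (+ 3 * O 5 n + - + 10 * O 3 n) + + 7 * O 1 n
        ≡⟨ solve 3 (λ s t u → # 1 :* (# 3 :* s :+ con (- + 10) :* t) :+ # 7 :* u :=
                              # 3 :* s :- # 10 :* t :+ # 7 :* u) refl (O 5 n) (O 3 n) (O 1 n) ⟩
      + 3 * O 5 n - + 10 * O 3 n + + 7 * O 1 n ∎

  -- Each of the three diagonal sums brings in fourth powers: through even cofactors, through
  -- Faulhaber's term - 15 e⁴ and through (e - 1) e⁴. Together these cancel, and only odd exponents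
  -- are left.
  conv-X1-X3 : ∀ n → + 480 * conv n (X 1) (X 3) ≡
    + 12 * X 5 n + + 20 * X 3 n - + 2 * X 1 n + + 30 * (O 5 n + V 5 n)
  conv-X1-X3 n = begin
    + 480 * conv n (X 1) (X 3)
      ≡⟨ cong (+ 480 *_) (conv-D n (λ a x → ε x * (+ a) ^ 1) (λ b y → ε y * (+ b) ^ 3)) ⟩
    + 480 * q
      ≡⟨ solve 1 (λ q → # 480 :* q := con (- + 30) :* (con (- + 16) :* q)) refl q ⟩
    - + 30 * (- + 16 * q)
      ≡⟨ cong (- + 30 *_) (trans (Q-quartic n (λ _ x → ε x)) liouville-ε) ⟩
    - + 30 * (+ 2 * (R - S) - T)
      ≡⟨ cong₂ (λ r t → - + 30 * (+ 2 * (r - S) - t)) R-eval T-eval ⟩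
    - + 30 * (+ 2 * (- W - S) - (T₅ - T₄))
      ≡⟨ solve 4 (λ w s t u → con (- + 30) :* (# 2 :* (:- w :- s) :- (t :- u)) :=
           # 30 :* (# 2 :* w) :+ # 2 :* (# 30 :* s) :+ # 30 :* (t :- u))
           refl W S T₅ T₄ ⟩
    + 30 * (+ 2 * W) + + 2 * (+ 30 * S) + + 30 * (T₅ - T₄)
      ≡⟨ cong₂ (λ w s → + 30 * w + + 2 * s + + 30 * (T₅ - T₄)) (D-even-cofactor 4 n) S-eval ⟩
    + 30 * (X 4 n + (O 4 n + V 4 n)) + + 2 * S′ + + 30 * (T₅ - T₄)
      ≡⟨ cong₂ (λ t u → + 30 * (X 4 n + (O 4 n + V 4 n)) + + 2 * S′ + + 30 * (t - u))
           (D-all 5 n) (D-all 4 n) ⟩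
    + 30 * (X 4 n + (O 4 n + V 4 n)) + + 2 * S′ + + 30 * ((O 5 n + V 5 n) - (O 4 n + V 4 n))
      ≡⟨ solve 6 (λ x5 x4 x3 x1 t u →
           # 30 :* (x4 :+ u) :+ # 2 :* (# 6 :* x5 :- # 15 :* x4 :+ # 10 :* x3 :- x1) :+ # 30 :* (t :- u) :=
           # 12 :* x5 :+ # 20 :* x3 :- # 2 :* x1 :+ # 30 :* t)
           refl (X 5 n) (X 4 n) (X 3 n) (X 1 n) (O 5 n + V 5 n) (O 4 n + V 4 n) ⟩
    + 12 * X 5 n + + 20 * X 3 n - + 2 * X 1 n + + 30 * (O 5 n + V 5 n) ∎
    where
    open Specialisations (_^ 4) (solve 1 (λ i → (:- i) :^ 4 := i :^ 4) refl) refl n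
    q R S S′ T W T₄ T₅ : ℤ
    q = Q n (λ a b x y → ε x * (+ a) ^ 1 * (ε y * (+ b) ^ 3))
    R = D n n (λ a e → ∑[ x ≤ e ℕ.∸ 1 ] ((+ a) ^ 4 * ε x))
    S = D n n (λ e x → ∑[ b ≤ e ℕ.∸ 1 ] (ε x * (+ b) ^ 4))
    S′ = + 6 * X 5 n - + 15 * X 4 n + + 10 * X 3 n - X 1 n
    T = D n n (λ e x → ∑[ b ≤ e ℕ.∸ 1 ] ((+ e) ^ 4))
    W = D n n (λ e x → even x * (+ e) ^ 4)
    T₄ = D n n (λ e x → (+ e) ^ 4)
    T₅ = D n n (λ e x → (+ e) ^ 5)
    χ : ℕ → ℕ → ℕ → ℤ
    χ k e x = ε x * (+ e) ^ k
    R-eval : R ≡ - W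
    R-eval = begin
      R
        -- The signs up to m cancel in pairs, leaving - 1 exactly when the cofactor e = m + 1 is
        -- even.
        ≡⟨ D-cong n (λ a m → trans (∑-*ˡ m ((+ suc a) ^ 4) ε) (trans (cong ((+ suc a) ^ 4 *_) (∑-ε m))
             (solve 2 (λ o p → p :* :- o :=
                  con -1ℤ :* ((# 1 :- (# 1 :- o)) :* p)) refl (odd m) ((+ suc a) ^ 4)))) ⟩
      D n n (λ a e → -1ℤ * (even e * (+ a) ^ 4))
        ≡⟨ D-* n -1ℤ (λ a e → even e * (+ a) ^ 4) ⟩
      -1ℤ * W
        ≡⟨ -1*i≡-i W ⟩
      - W ∎
    T-eval : T ≡ T₅ - T₄
    T-eval = begin
      T
        ≡⟨ D-cong n (λ m x → trans (∑-const m ((+ suc m) ^ 4))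
             (solve 1 (λ m → m :* (# 1 :+ m) :^ 4 :=
                  # 1 :* (# 1 :+ m) :^ 5 :+ con -1ℤ :* (# 1 :+ m) :^ 4) refl (+ m))) ⟩
      D n n (λ e x → 1ℤ * (+ e) ^ 5 + -1ℤ * (+ e) ^ 4)
        ≡⟨ D-linear n 1ℤ -1ℤ (λ e x → (+ e) ^ 5) (λ e x → (+ e) ^ 4) ⟩
      1ℤ * T₅ + -1ℤ * T₄
        ≡⟨ solve 2 (λ s t → # 1 :* s :+ con -1ℤ :* t := s :- t) refl T₅ T₄ ⟩
      T₅ - T₄ ∎
    S-eval : + 30 * S ≡ S′
    S-eval = begin
      + 30 * S
        ≡⟨ sym (D-* n (+ 30) (λ e x → ∑[ b ≤ e ℕ.∸ 1 ] (ε x * (+ b) ^ 4))) ⟩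
      D n n (λ e x → + 30 * ∑[ b ≤ e ℕ.∸ 1 ] (ε x * (+ b) ^ 4))
        ≡⟨ D-cong n inner ⟩
      D n n (λ e x → 1ℤ * f e x + 1ℤ * g e x)
        ≡⟨ D-linear n 1ℤ 1ℤ f g ⟩
      1ℤ * D n n f + 1ℤ * D n n g
        ≡⟨ cong₂ (λ s t → 1ℤ * s + 1ℤ * t)
             (D-linear n (+ 6) (- + 15) (χ 5) (χ 4)) (D-linear n (+ 10) -1ℤ (χ 3) (χ 1)) ⟩
      1ℤ * (+ 6 * X 5 n + - + 15 * X 4 n) + 1ℤ * (+ 10 * X 3 n + -1ℤ * X 1 n)
        ≡⟨ solve 4 (λ s t u v → # 1 :* (# 6 :* s :+ con (- + 15) :* t) :+ # 1 :* (# 10 :* u :+ con -1ℤ :* v) :=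
                                # 6 :* s :- # 15 :* t :+ # 10 :* u :- v)
             refl (X 5 n) (X 4 n) (X 3 n) (X 1 n) ⟩
      + 6 * X 5 n - + 15 * X 4 n + + 10 * X 3 n - X 1 n ∎
      where
      f g : ℕ → ℕ → ℤ
      f e x = + 6 * χ 5 e x + - + 15 * χ 4 e x
      g e x = + 10 * χ 3 e x + -1ℤ * χ 1 e x
      inner : ∀ m x → + 30 * ∑[ b ≤ m ] (ε (suc x) * (+ b) ^ 4) ≡
                      1ℤ * f (suc m) (suc x) + 1ℤ * g (suc m) (suc x)
      inner m x = begin
        + 30 * ∑[ b ≤ m ] (ε (suc x) * (+ b) ^ 4)
          ≡⟨ cong (+ 30 *_) (∑-*ˡ m (ε (suc x)) (λ b → (+ b) ^ 4)) ⟩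
        + 30 * (ε (suc x) * ∑[ b ≤ m ] ((+ b) ^ 4))
          ≡⟨ solve 2 (λ e s → # 30 :* (e :* s) :=
               e :* (# 30 :* s)) refl (ε (suc x)) (∑[ b ≤ m ] ((+ b) ^ 4)) ⟩
        ε (suc x) * (+ 30 * ∑[ b ≤ m ] ((+ b) ^ 4))
          ≡⟨ cong (ε (suc x) *_) (∑⁴-closed m) ⟩
        ε (suc x) * (+ 6 * (+ suc m) ^ 5 - + 15 * (+ suc m) ^ 4 + + 10 * (+ suc m) ^ 3 - + suc m)
          ≡⟨ solve 2 (λ x e → x :* (# 6 :* e :^ 5 :- # 15 :* e :^ 4 :+ # 10 :* e :^ 3 :- e) :=
               # 1 :* (# 6 :* (x :* e :^ 5) :+ con (- + 15) :* (x :* e :^ 4)) :+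
                 # 1 :* (# 10 :* (x :* e :^ 3) :+ con -1ℤ :* (x :* e :^ 1)))
               refl (ε (suc x)) (+ suc m) ⟩
        _ ∎

  -- The divisor functions in terms of `O` and `V`

  σ≡ : ∀ k n .{{_ : NonZero n}} → σ k n ≡ O k n + V k n
  σ≡ k n = trans (∑-divisors≡D n (λ d → (+ d) ^ k) (λ e x → (+ e) ^ k) (λ _ _ _ → refl)) (D-all k n)

  σ~≡ : ∀ k n .{{_ : NonZero n}} → σ~ k n ≡ O k n - V k n
  σ~≡ k n = begin
    σ~ k n
      ≡⟨ ∑-divisors≡D n (λ d → (-1ℤ ^ (d ℕ.∸ 1)) * (+ d) ^ k)
           (λ e x → 1ℤ * (odd e * (+ e) ^ k) + -1ℤ * (even e * (+ e) ^ k))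
           (λ d x _ → trans (cong (_* (+ suc d) ^ k) (ε≡2even-1 d))
             (solve 2 (λ o p → (# 2 :* (# 1 :- o) :- # 1) :* p :=
                # 1 :* ((# 1 :- o) :* p) :+ con -1ℤ :* ((# 1 :- (# 1 :- o)) :* p))
                refl (odd d) ((+ suc d) ^ k))) ⟩
    D n n (λ e x → 1ℤ * (odd e * (+ e) ^ k) + -1ℤ * (even e * (+ e) ^ k))
      ≡⟨ D-linear n 1ℤ -1ℤ (λ e x → odd e * (+ e) ^ k) (λ e x → even e * (+ e) ^ k) ⟩
    1ℤ * O k n + -1ℤ * V k n
      ≡⟨ solve 2 (λ s t → # 1 :* s :+ con -1ℤ :* t := s :- t) refl (O k n) (V k n) ⟩
    O k n - V k n ∎

  -- The sign (-1)^(x-1) on the cofactor is - ε x, so this is `X1` up to sign.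
  σ^≡ : ∀ n .{{_ : NonZero n}} → σ^ n ≡ O 1 n
  σ^≡ n = begin
    σ^ n
      ≡⟨ ∑-divisors≡D n (λ d → (-1ℤ ^ ((n div d) ℕ.∸ 1)) * (+ d)) (λ e x → -1ℤ * (ε x * (+ e) ^ 1))
           (λ d x d*x≡n → trans (cong (λ q → -1ℤ ^ (q ℕ.∸ 1) * + suc d) (quotient d x d*x≡n))
             (solve 2 (λ s e → s :* e :=
                  con -1ℤ :* ((con -1ℤ :* s) :* e :^ 1)) refl (ε x) (+ suc d))) ⟩
    D n n (λ e x → -1ℤ * (ε x * (+ e) ^ 1))
      ≡⟨ D-* n -1ℤ (λ e x → ε x * (+ e) ^ 1) ⟩
    -1ℤ * X 1 n
      ≡⟨ cong (-1ℤ *_) (X1 n) ⟩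
    -1ℤ * - O 1 n
      ≡⟨ solve 1 (λ o → con -1ℤ :* :- o := o) refl (O 1 n) ⟩
    O 1 n ∎
    where
    quotient : ∀ d x → suc d ℕ.* suc x ≡ n → n div suc d ≡ suc x
    quotient d x d*x≡n = trans
      (cong (λ m → m div suc d) (trans (sym d*x≡n) (ℕ.*-comm (suc d) (suc x))))
      (m*n/n≡m (suc x) (suc d))

  -- Convolutions with constant terms

  ∑₀ : ℕ → (ℕ → ℤ) → ℤ
  ∑₀ n f = f 0 + ∑ n f

  infixl 10 ∑₀
  syntax ∑₀ n (λ d → t) = ∑₀[ d ≤ n ] t

  ∑₀≡∑ : ∀ n f → ∑₀ n f ≡ ∑[ d ≤ suc n ] f (d ℕ.∸ 1)
  ∑₀≡∑ n f = cong (_+_ (f 0)) (∑-cong n λ _ → refl)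

  ∑₀-cong : ∀ n {f g : ℕ → ℤ} → (∀ d → f d ≡ g d) → ∑₀ n f ≡ ∑₀ n g
  ∑₀-cong n f≗g = cong₂ _+_ (f≗g 0) (∑-cong n (f≗g ∘ suc))

  ∑₀-swap : ∀ m n (h : ℕ → ℕ → ℤ) → ∑₀[ i ≤ m ] ∑₀[ j ≤ n ] h i j ≡ ∑₀[ j ≤ n ] ∑₀[ i ≤ m ] h i j
  ∑₀-swap m n h = begin
    h 0 0 + ∑ n (h 0) + ∑[ i ≤ m ] (h i 0 + ∑ n (h i))
      ≡⟨ cong (_+_ (h 0 0 + ∑ n (h 0))) (∑-+ m (λ i → h i 0) (λ i → ∑ n (h i))) ⟩
    h 0 0 + ∑ n (h 0) + (∑[ i ≤ m ] h i 0 + ∑[ i ≤ m ] ∑[ j ≤ n ] h i j)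
      ≡⟨ cong (λ t → h 0 0 + ∑ n (h 0) + (∑[ i ≤ m ] h i 0 + t)) (∑-swap m n h) ⟩
    h 0 0 + ∑ n (h 0) + (∑[ i ≤ m ] h i 0 + ∑[ j ≤ n ] ∑[ i ≤ m ] h i j)
      ≡⟨ solve 4 (λ a b c d → a :+ b :+ (c :+ d) := a :+ c :+ (b :+ d)) refl
           (h 0 0) (∑ n (h 0)) (∑[ i ≤ m ] h i 0) (∑[ j ≤ n ] ∑[ i ≤ m ] h i j) ⟩
    h 0 0 + ∑[ i ≤ m ] h i 0 + (∑ n (h 0) + ∑[ j ≤ n ] ∑[ i ≤ m ] h i j)
      ≡⟨ cong (_+_ (h 0 0 + ∑[ i ≤ m ] h i 0)) (sym (∑-+ n (h 0) (λ j → ∑[ i ≤ m ] h i j))) ⟩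
    h 0 0 + ∑[ i ≤ m ] h i 0 + ∑[ j ≤ n ] (h 0 j + ∑[ i ≤ m ] h i j) ∎

  ∑₀-*ˡ : ∀ n c f → ∑₀[ d ≤ n ] (c * f d) ≡ c * ∑₀ n f
  ∑₀-*ˡ n c f = trans (cong (_+_ (c * f 0)) (∑-*ˡ n c f)) (sym (*-distribˡ-+ c (f 0) (∑ n f)))

  ∑₀-extend : ∀ {m n} f → m ≤ n → (∀ d → m < d → f d ≡ 0ℤ) → ∑₀ n f ≡ ∑₀ m f
  ∑₀-extend f m≤n f≡0 = cong (_+_ (f 0)) (∑-extend f m≤n f≡0)

  ∑₀-δ : ∀ n k (c : ℕ → ℤ) → (∀ d → n < d → c d ≡ 0ℤ) → ∑₀[ d ≤ n ] δ k d (c d) ≡ c k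
  ∑₀-δ n zero    c c≡0 = trans (cong₂ _+_ (δ-≡ (c 0) refl) (∑-zero n λ d → δ-≢ _ λ ())) (+-identityʳ (c 0))
  ∑₀-δ n (suc k) c c≡0 = trans (cong₂ _+_ (δ-≢ (c 0) λ ()) (∑-δ n k c c≡0)) (+-identityˡ (c (suc k)))

  -- The range `N` is kept apart from the total `n`, so that convolutions with varying totals can
  -- share one range.
  conv₀ : ℕ → ℕ → (ℕ → ℤ) → (ℕ → ℤ) → ℤ
  conv₀ N n u v = ∑₀[ i ≤ N ] ∑₀[ j ≤ N ] δ (i ℕ.+ j) n (u i * v j)

  conv₀-extend : ∀ {N n} u v → n ≤ N → conv₀ N n u v ≡ conv₀ n n u v
  conv₀-extend {N} {n} u v n≤N = trans
    (∑₀-cong N λ i → ∑₀-extend (λ j → δ (i ℕ.+ j) n (u i * v j)) n≤N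
      λ j n<j → δ-> _ (ℕ.≤-trans n<j (ℕ.m≤n+m j i)))
    (∑₀-extend (λ i → ∑₀[ j ≤ n ] δ (i ℕ.+ j) n (u i * v j)) n≤N
      λ i n<i → trans (∑₀-cong n λ j → trans (δ-> _ (ℕ.≤-trans n<i (ℕ.m≤m+n i j))) (sym (*-zeroˡ 0ℤ)))
                      (trans (∑₀-*ˡ n 0ℤ (λ _ → 0ℤ)) (*-zeroˡ (∑₀ n (λ _ → 0ℤ)))))

  -- The evaluations of `conv` concern positive indices only, so the two terms with one zero index
  -- are isolated. The corner i = j = 0 has total 0 and drops out.
  conv₀-split : ∀ n u v → conv₀ (suc n) (suc n) u v ≡ u 0 * v (suc n) + u (suc n) * v 0 + conv (suc n) u v
  conv₀-split n u v = begin
    (δ 0 (suc n) (u 0 * v 0) + ∑[ j ≤ N ] δ j N (u 0 * v j)) +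
      ∑[ i ≤ N ] (δ (i ℕ.+ 0) N (u i * v 0) + ∑[ j ≤ N ] δ (i ℕ.+ j) N (u i * v j))
      ≡⟨ cong₂ _+_ (cong₂ _+_ (δ-≢ (u 0 * v 0) λ ()) (only (λ j → u 0 * v j) id (λ _ → refl)))
           (trans (∑-+ N (λ i → δ (i ℕ.+ 0) N (u i * v 0)) (λ i → ∑[ j ≤ N ] δ (i ℕ.+ j) N (u i * v j)))
                  (cong (_+ conv N u v) (only (λ i → u i * v 0) (ℕ._+ 0) ℕ.+-identityʳ))) ⟩
    (0ℤ + u 0 * v N) + (u N * v 0 + conv N u v)
      ≡⟨ solve 3 (λ a b c → (# 0 :+ a) :+ (b :+ c) :=
           a :+ b :+ c) refl (u 0 * v N) (u N * v 0) (conv N u v) ⟩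
    u 0 * v N + u N * v 0 + conv N u v ∎
    where
    N = suc n
    only : ∀ (c : ℕ → ℤ) (f : ℕ → ℕ) → (∀ i → f i ≡ i) → ∑[ i ≤ N ] δ (f i) N (c i) ≡ c N
    only c f f≗id = trans
      (∑-single N (λ i → δ (f i) N (c i)) (ℕ.n<1+n n) λ d d≢n →
        δ-≢ _ λ eq → d≢n (ℕ.suc-injective (trans (sym (f≗id (suc d))) eq)))
      (δ-≡ _ (f≗id N))

  -- A new index m = i + j is inserted by `∑₀-δ`. After the sums are exchanged, the inner ones form
  -- the convolution at m, and m + k = n permits their range to shrink from n to m.
  conv₀-assoc : ∀ n u v w →
    ∑₀[ i ≤ n ] ∑₀[ j ≤ n ] ∑₀[ k ≤ n ] δ (i ℕ.+ j ℕ.+ k) n (u i * v j * w k) ≡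
    conv₀ n n (λ m → conv₀ m m u v) w
  conv₀-assoc n u v w = begin
    ∑₀[ i ≤ n ] ∑₀[ j ≤ n ] ∑₀[ k ≤ n ] δ (i ℕ.+ j ℕ.+ k) n (u i * v j * w k)
      ≡⟨ ∑₀-cong n (λ i → ∑₀-cong n λ j → inner i j) ⟩
    ∑₀[ i ≤ n ] ∑₀[ j ≤ n ] ∑₀[ m ≤ n ] (C m * δ (i ℕ.+ j) m (u i * v j))
      ≡⟨ ∑₀-cong n (λ i → ∑₀-swap n n λ j m → C m * δ (i ℕ.+ j) m (u i * v j)) ⟩
    ∑₀[ i ≤ n ] ∑₀[ m ≤ n ] ∑₀[ j ≤ n ] (C m * δ (i ℕ.+ j) m (u i * v j))
      ≡⟨ ∑₀-swap n n (λ i m → ∑₀[ j ≤ n ] (C m * δ (i ℕ.+ j) m (u i * v j))) ⟩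
    ∑₀[ m ≤ n ] ∑₀[ i ≤ n ] ∑₀[ j ≤ n ] (C m * δ (i ℕ.+ j) m (u i * v j))
      ≡⟨ ∑₀-cong n (λ m → trans
           (∑₀-cong n λ i → ∑₀-*ˡ n (C m) λ j → δ (i ℕ.+ j) m (u i * v j))
           (∑₀-*ˡ n (C m) λ i → ∑₀[ j ≤ n ] δ (i ℕ.+ j) m (u i * v j))) ⟩
    ∑₀[ m ≤ n ] (C m * conv₀ n m u v)
      ≡⟨ ∑₀-cong n (λ m → trans (*-comm (C m) (conv₀ n m u v)) (sym (trans
           (∑₀-cong n λ k → δ-* (m ℕ.+ k) n (conv₀ n m u v) (w k))
           (∑₀-*ˡ n (conv₀ n m u v) λ k → δ (m ℕ.+ k) n (w k))))) ⟩
    ∑₀[ m ≤ n ] ∑₀[ k ≤ n ] δ (m ℕ.+ k) n (conv₀ n m u v * w k)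
      ≡⟨ ∑₀-cong n (λ m → ∑₀-cong n λ k → δ-cong λ m+k≡n →
           cong (_* w k) (conv₀-extend u v (subst (m ≤_) m+k≡n (ℕ.m≤m+n m k)))) ⟩
    conv₀ n n (λ m → conv₀ m m u v) w ∎
    where
    -- `C m` is w (n - m) for m ≤ n and 0 beyond, expressed without subtraction.
    C : ℕ → ℤ
    C m = ∑₀[ k ≤ n ] δ (m ℕ.+ k) n (w k)
    C≡0 : ∀ m → n < m → C m ≡ 0ℤ
    C≡0 m n<m = cong₂ _+_ (vanish 0) (∑-zero n λ k → vanish (suc k))
      where
      vanish : ∀ k → δ (m ℕ.+ k) n (w k) ≡ 0ℤ
      vanish k = δ-> (w k) (ℕ.≤-trans n<m (ℕ.m≤m+n m k))
    inner : ∀ i j → ∑₀[ k ≤ n ] δ (i ℕ.+ j ℕ.+ k) n (u i * v j * w k) ≡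
                    ∑₀[ m ≤ n ] (C m * δ (i ℕ.+ j) m (u i * v j))
    inner i j = begin
      ∑₀[ k ≤ n ] δ (i ℕ.+ j ℕ.+ k) n (u i * v j * w k)
        ≡⟨ ∑₀-cong n (λ k → δ-* (i ℕ.+ j ℕ.+ k) n (u i * v j) (w k)) ⟩
      ∑₀[ k ≤ n ] (u i * v j * δ (i ℕ.+ j ℕ.+ k) n (w k))
        ≡⟨ ∑₀-*ˡ n (u i * v j) (λ k → δ (i ℕ.+ j ℕ.+ k) n (w k)) ⟩
      u i * v j * C (i ℕ.+ j)
        ≡⟨ *-comm (u i * v j) (C (i ℕ.+ j)) ⟩
      C (i ℕ.+ j) * (u i * v j)
        ≡⟨ sym (∑₀-δ n (i ℕ.+ j) (λ m → C m * (u i * v j)) λ m n<m → cong (_* (u i * v j)) (C≡0 m n<m)) ⟩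
      ∑₀[ m ≤ n ] δ (i ℕ.+ j) m (C m * (u i * v j))
        ≡⟨ ∑₀-cong n (λ m → δ-* (i ℕ.+ j) m (C m) (u i * v j)) ⟩
      ∑₀[ m ≤ n ] (C m * δ (i ℕ.+ j) m (u i * v j)) ∎

  -- From lists of pairs and triples to indexed sums

  sumℤ-++ : ∀ xs ys → sumℤ (xs ++ ys) ≡ sumℤ xs + sumℤ ys
  sumℤ-++ []       ys = sym (+-identityˡ (sumℤ ys))
  sumℤ-++ (x ∷ xs) ys = trans (cong (_+_ x) (sumℤ-++ xs ys)) (sym (+-assoc x (sumℤ xs) (sumℤ ys)))

  sumℤ-cartesianProduct : ∀ {A B : Set} (f : A × B → ℤ) xs ys →
    sumℤ (map f (cartesianProduct xs ys)) ≡ sumℤ (map (λ x → sumℤ (map (λ y → f (x , y)) ys)) xs)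
  sumℤ-cartesianProduct f []       ys = refl
  sumℤ-cartesianProduct f (x ∷ xs) ys = begin
    sumℤ (map f (map (x ,_) ys ++ cartesianProduct xs ys))
      ≡⟨ cong sumℤ (map-++ f (map (x ,_) ys) (cartesianProduct xs ys)) ⟩
    sumℤ (map f (map (x ,_) ys) ++ map f (cartesianProduct xs ys))
      ≡⟨ sumℤ-++ (map f (map (x ,_) ys)) (map f (cartesianProduct xs ys)) ⟩
    sumℤ (map f (map (x ,_) ys)) + sumℤ (map f (cartesianProduct xs ys))
      ≡⟨ cong₂ _+_ (cong sumℤ (sym (map-∘ ys))) (sumℤ-cartesianProduct f xs ys) ⟩
    sumℤ (map (λ y → f (x , y)) ys) + sumℤ (map (λ x → sumℤ (map (λ y → f (x , y)) ys)) xs) ∎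

  sumℤ-upTo : ∀ n {f g : ℕ → ℤ} → (∀ k → f k ≡ g k) → sumℤ (map f (upTo (suc n))) ≡ ∑₀ n g
  sumℤ-upTo n {f} {g} f≗g = trans
    (sumℤ-applyUpTo f (λ d → g (d ℕ.∸ 1)) id (suc n) f≗g)
    (sym (∑₀≡∑ n g))

  sumℤ-pairs : ∀ n u v → sumℤ (map (λ (i , j) → u i * v j) (pairs n)) ≡ conv₀ n n u v
  sumℤ-pairs n u v = begin
    sumℤ (map (λ (i , j) → u i * v j) (pairs n))
      ≡⟨ sumℤ-filter (λ (i , j) → i ℕ.+ j ℕ.≟ n) (λ (i , j) → u i * v j) (cartesianProduct U U) ⟩
    sumℤ (map f (cartesianProduct U U))
      ≡⟨ sumℤ-cartesianProduct f U U ⟩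
    sumℤ (map (λ i → sumℤ (map (λ j → f (i , j)) U)) U)
      ≡⟨ sumℤ-upTo n (λ i → sumℤ-upTo n λ j → sym (δ-if (i ℕ.+ j) n (u i * v j))) ⟩
    conv₀ n n u v ∎
    where
    U = upTo (suc n)
    f : ℕ × ℕ → ℤ
    f (i , j) = if does (i ℕ.+ j ℕ.≟ n) then u i * v j else 0ℤ

  sumℤ-triples : ∀ n u v w → sumℤ (map (λ (i , j , k) → u i * v j * w k) (triples n)) ≡
    conv₀ n n (λ m → conv₀ m m u v) w
  sumℤ-triples n u v w = begin
    sumℤ (map (λ (i , j , k) → u i * v j * w k) (triples n))
      ≡⟨ sumℤ-filter (λ (i , j , k) → i ℕ.+ j ℕ.+ k ℕ.≟ n) (λ (i , j , k) → u i * v j * w k)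
           (cartesianProduct U (cartesianProduct U U)) ⟩
    sumℤ (map f (cartesianProduct U (cartesianProduct U U)))
      ≡⟨ sumℤ-cartesianProduct f U (cartesianProduct U U) ⟩
    sumℤ (map (λ i → sumℤ (map (λ (j , k) → f (i , j , k)) (cartesianProduct U U))) U)
      ≡⟨ sumℤ-upTo n (λ i → trans (sumℤ-cartesianProduct (λ (j , k) → f (i , j , k)) U U)
           (sumℤ-upTo n λ j → sumℤ-upTo n λ k → sym (δ-if (i ℕ.+ j ℕ.+ k) n (u i * v j * w k)))) ⟩
    ∑₀[ i ≤ n ] ∑₀[ j ≤ n ] ∑₀[ k ≤ n ] δ (i ℕ.+ j ℕ.+ k) n (u i * v j * w k)
      ≡⟨ conv₀-assoc n u v w ⟩
    conv₀ n n (λ m → conv₀ m m u v) w ∎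
    where
    U = upTo (suc n)
    f : ℕ × ℕ × ℕ → ℤ
    f (i , j , k) = if does (i ℕ.+ j ℕ.+ k ℕ.≟ n) then u i * v j * w k else 0ℤ

  -- The square and the cube of the series of σ̂

  conv-linear : ∀ n c d (u v a b a′ b′ : ℕ → ℤ) →
    (∀ i j → u (suc i) * v (suc j) ≡ c * (a (suc i) * b (suc j)) + d * (a′ (suc i) * b′ (suc j))) →
    conv n u v ≡ c * conv n a b + d * conv n a′ b′
  conv-linear n c d u v a b a′ b′ eq = begin
    conv n u v
      ≡⟨ ∑²-cong n (λ i j → trans (cong (δ (suc i ℕ.+ suc j) n) (eq i j))
           (trans (δ-+ (suc i ℕ.+ suc j) n (c * (a (suc i) * b (suc j))) (d * (a′ (suc i) * b′ (suc j))))
                  (cong₂ _+_ (δ-* (suc i ℕ.+ suc j) n c (a (suc i) * b (suc j)))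
                             (δ-* (suc i ℕ.+ suc j) n d (a′ (suc i) * b′ (suc j)))))) ⟩
    ∑² n (λ i j → c * δ (i ℕ.+ j) n (a i * b j) + d * δ (i ℕ.+ j) n (a′ i * b′ j))
      ≡⟨ ∑²-+ n (λ i j → c * δ (i ℕ.+ j) n (a i * b j)) (λ i j → d * δ (i ℕ.+ j) n (a′ i * b′ j)) ⟩
    ∑² n (λ i j → c * δ (i ℕ.+ j) n (a i * b j)) + ∑² n (λ i j → d * δ (i ℕ.+ j) n (a′ i * b′ j))
      ≡⟨ cong₂ _+_ (∑²-*ˡ n c (λ i j → δ (i ℕ.+ j) n (a i * b j)))
                   (∑²-*ˡ n d (λ i j → δ (i ℕ.+ j) n (a′ i * b′ j))) ⟩
    c * conv n a b + d * conv n a′ b′ ∎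

  conv-comm : ∀ n u v → conv n u v ≡ conv n v u
  conv-comm n u v = trans (∑²-flip n λ i j → δ (i ℕ.+ j) n (u i * v j))
    (∑²-cong n λ j i → cong₂ (λ m → δ m n) (ℕ.+-comm (suc i) (suc j)) (*-comm (u (suc i)) (v (suc j))))

  -- Scaling by 24 turns the constant term 1/24 into 1 and makes all values integers.
  24σ̂ : ℕ → ℤ
  24σ̂ zero      = 1ℤ
  24σ̂ n@(suc _) = + 24 * O 1 n

  -- The terms with a zero index contribute 48 O 1, which cancels the - 48 O 1 left by `conv-O1-O1`.
  -- This is what dictates σ̂(0) = 1/24.
  convolution-square : ∀ n .{{_ : NonZero n}} → conv₀ n n 24σ̂ 24σ̂ ≡ + 48 * O 3 n + + 72 * V 3 n
  convolution-square n@(suc m) = begin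
    conv₀ n n 24σ̂ 24σ̂
      ≡⟨ conv₀-split m 24σ̂ 24σ̂ ⟩
    1ℤ * (+ 24 * O 1 n) + + 24 * O 1 n * 1ℤ + conv n 24σ̂ 24σ̂
      ≡⟨ cong (λ t → 1ℤ * (+ 24 * O 1 n) + + 24 * O 1 n * 1ℤ + t)
           (conv-linear n (+ 576) 0ℤ 24σ̂ 24σ̂ (O 1) (O 1) (O 1) (O 1) λ i j →
              solve 2 (λ a b → # 24 :* a :* (# 24 :* b) := # 576 :* (a :* b) :+ # 0 :* (a :* b))
                refl (O 1 (suc i)) (O 1 (suc j))) ⟩
    1ℤ * (+ 24 * O 1 n) + + 24 * O 1 n * 1ℤ + (+ 576 * q + 0ℤ * q)
      ≡⟨ solve 2 (λ o q → # 1 :* (# 24 :* o) :+ # 24 :* o :* # 1 :+ (# 576 :* q :+ # 0 :* q) :=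
                          # 48 :* o :+ # 24 :* (# 24 :* q)) refl (O 1 n) q ⟩
    + 48 * O 1 n + + 24 * (+ 24 * q)
      ≡⟨ cong (λ t → + 48 * O 1 n + + 24 * t) (conv-O1-O1 n) ⟩
    + 48 * O 1 n + + 24 * (+ 2 * (O 3 n - O 1 n) + + 3 * V 3 n)
      ≡⟨ solve 3 (λ o o3 v3 → # 48 :* o :+ # 24 :* (# 2 :* (o3 :- o) :+ # 3 :* v3) :=
                              # 48 :* o3 :+ # 72 :* v3) refl (O 1 n) (O 3 n) (V 3 n) ⟩
    + 48 * O 3 n + + 72 * V 3 n ∎
    where
    q = conv n (O 1) (O 1)

  -- The factor 5 adapts the coefficients to the two evaluated convolutions: 5 · 2304 = 24 · 480 and
  -- 5 · 1152 = 12 · 480. The first and third powers that these produce cancel against the terms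
  -- with a zero index.
  convolution-cube : ∀ n .{{_ : NonZero n}} →
    conv₀ n n (λ m → conv₀ m m 24σ̂ 24σ̂) 24σ̂ ≡ + 72 * O 5 n + + 54 * V 5 n
  convolution-cube n@(suc m) = *-cancelˡ-≡ (+ 5) _ _ (begin
    + 5 * conv₀ n n h 24σ̂
      ≡⟨ cong (+ 5 *_) (trans (conv₀-split m h 24σ̂)
           (cong₂ (λ s t → s * (+ 24 * O 1 n) + t * 1ℤ + conv n h 24σ̂) h0 (convolution-square n))) ⟩
    + 5 * (1ℤ * (+ 24 * O 1 n) + (+ 48 * O 3 n + + 72 * V 3 n) * 1ℤ + conv n h 24σ̂)
      ≡⟨ cong (λ t → + 5 * (1ℤ * (+ 24 * O 1 n) + (+ 48 * O 3 n + + 72 * V 3 n) * 1ℤ + t)) (begin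
           conv n h 24σ̂
             ≡⟨ conv-linear n (+ 2304) (- (+ 1152)) h 24σ̂ (X 3) (X 1) (O 3) (O 1) split ⟩
           + 2304 * conv n (X 3) (X 1) + - (+ 1152) * conv n (O 3) (O 1)
             ≡⟨ cong₂ (λ s t → + 2304 * s + - (+ 1152) * t)
                  (conv-comm n (X 3) (X 1)) (conv-comm n (O 3) (O 1)) ⟩
           + 2304 * r + - (+ 1152) * q ∎) ⟩
    + 5 * (1ℤ * (+ 24 * O 1 n) + (+ 48 * O 3 n + + 72 * V 3 n) * 1ℤ + (+ 2304 * r + - (+ 1152) * q))
      ≡⟨ solve 5 (λ o1 o3 v3 r q →
           # 5 :* (# 1 :* (# 24 :* o1) :+ (# 48 :* o3 :+ # 72 :* v3) :* # 1 :+
                         (# 2304 :* r :+ con (- (+ 1152)) :* q)) :=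
           # 120 :* o1 :+ # 240 :* o3 :+ # 360 :* v3 :+
             # 24 :* (# 480 :* r) :- # 12 :* (# 480 :* q))
           refl (O 1 n) (O 3 n) (V 3 n) r q ⟩
    + 120 * O 1 n + + 240 * O 3 n + + 360 * V 3 n + + 24 * (+ 480 * r) - + 12 * (+ 480 * q)
      ≡⟨ cong₂ (λ s t → + 120 * O 1 n + + 240 * O 3 n + + 360 * V 3 n + + 24 * s - + 12 * t)
           (conv-X1-X3 n) (conv-O1-O3 n) ⟩
    + 120 * O 1 n + + 240 * O 3 n + + 360 * V 3 n
      + + 24 * (+ 12 * X 5 n + + 20 * X 3 n - + 2 * X 1 n + + 30 * (O 5 n + V 5 n))
      - + 12 * (+ 2 * (+ 3 * O 5 n - + 10 * O 3 n + + 7 * O 1 n) + + 15 * V 5 n)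
      ≡⟨ solve 8 (λ o1 o3 v3 x5 x3 x1 o5 v5 →
           # 120 :* o1 :+ # 240 :* o3 :+ # 360 :* v3
             :+ # 24 :* (# 12 :* x5 :+ # 20 :* x3 :- # 2 :* x1 :+ # 30 :* (o5 :+ v5))
             :- # 12 :* (# 2 :* (# 3 :* o5 :- # 10 :* o3 :+ # 7 :* o1) :+ # 15 :* v5) :=
           # 18 :* (# 16 :* x5) :+ # 120 :* (# 4 :* x3) :- # 48 :* x1
             :+ (# 480 :* o3 :+ # 360 :* v3 :- # 48 :* o1 :+ # 648 :* o5 :+ # 540 :* v5))
           refl (O 1 n) (O 3 n) (V 3 n) (X 5 n) (X 3 n) (X 1 n) (O 5 n) (V 5 n) ⟩
    + 18 * (+ 16 * X 5 n) + + 120 * (+ 4 * X 3 n) - + 48 * X 1 n + rest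
      ≡⟨ cong₂ (λ s t → + 18 * s + + 120 * t - + 48 * X 1 n + rest) (16*X5 n) (4*X3 n) ⟩
    + 18 * - x₅ + + 120 * - x₃ - + 48 * X 1 n + rest
      ≡⟨ cong (λ t → + 18 * - x₅ + + 120 * - x₃ - + 48 * t + rest) (X1 n) ⟩
    + 18 * - x₅ + + 120 * - x₃ - + 48 * - O 1 n + rest
      ≡⟨ solve 5 (λ o1 o3 v3 o5 v5 →
           # 18 :* (:- (# 16 :* o5 :+ # 15 :* v5))
             :+ # 120 :* (:- (# 4 :* o3 :+ # 3 :* v3)) :- # 48 :* (:- o1)
             :+ (# 480 :* o3 :+ # 360 :* v3 :- # 48 :* o1 :+ # 648 :* o5 :+ # 540 :* v5) :=
           # 5 :* (# 72 :* o5 :+ # 54 :* v5))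
           refl (O 1 n) (O 3 n) (V 3 n) (O 5 n) (V 5 n) ⟩
    + 5 * (+ 72 * O 5 n + + 54 * V 5 n) ∎)
    where
    h : ℕ → ℤ
    h k = conv₀ k k 24σ̂ 24σ̂
    q r x₃ x₅ rest : ℤ
    x₃ = + 4 * O 3 n + + 3 * V 3 n
    x₅ = + 16 * O 5 n + + 15 * V 5 n
    q = conv n (O 1) (O 3)
    r = conv n (X 1) (X 3)
    rest = + 480 * O 3 n + + 360 * V 3 n - + 48 * O 1 n + + 648 * O 5 n + + 540 * V 5 n
    h0 : h 0 ≡ 1ℤ
    h0 = trans (+-identityʳ _) (trans (+-identityʳ _) (δ-≡ 1ℤ refl))
    split : ∀ i j → h (suc i) * 24σ̂ (suc j) ≡
      + 2304 * (X 3 (suc i) * X 1 (suc j)) + - (+ 1152) * (O 3 (suc i) * O 1 (suc j))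
    split i j = begin
      h (suc i) * (+ 24 * O 1 (suc j))
        ≡⟨ cong (_* (+ 24 * O 1 (suc j))) (convolution-square (suc i)) ⟩
      (+ 48 * O 3 (suc i) + + 72 * V 3 (suc i)) * (+ 24 * O 1 (suc j))
        -- 24 (4 O 3 + 3 V 3) absorbs the coefficient 72 of `V 3` and exceeds the 48 O 3 by another
        -- 48 O 3, which is subtracted. The factor 24 of the first-power sum turns 24 and 48 into
        -- 576 and 1152.
        ≡⟨ solve 3 (λ o v p → (# 48 :* o :+ # 72 :* v) :* (# 24 :* p) :=
             # 576 :* ((:- (# 4 :* o :+ # 3 :* v)) :* (:- p)) :+ con (- (+ 1152)) :* (o :* p))
             refl (O 3 (suc i)) (V 3 (suc i)) (O 1 (suc j)) ⟩
      + 576 * (- (+ 4 * O 3 (suc i) + + 3 * V 3 (suc i)) * - O 1 (suc j)) + - (+ 1152) * (O 3 (suc i) * O 1 (suc j))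
        ≡⟨ cong₂ (λ s t → + 576 * (s * t) + - (+ 1152) * (O 3 (suc i) * O 1 (suc j)))
             (sym (4*X3 (suc i))) (sym (X1 (suc j))) ⟩
      + 576 * (+ 4 * X 3 (suc i) * X 1 (suc j)) + - (+ 1152) * (O 3 (suc i) * O 1 (suc j))
        ≡⟨ solve 3 (λ x y z → # 576 :* (# 4 :* x :* y) :+ z := # 2304 :* (x :* y) :+ z)
             refl (X 3 (suc i)) (X 1 (suc j)) (- (+ 1152) * (O 3 (suc i) * O 1 (suc j))) ⟩
      + 2304 * (X 3 (suc i) * X 1 (suc j)) + - (+ 1152) * (O 3 (suc i) * O 1 (suc j)) ∎

-- Passage to the rationals

open import Data.Rational.Base using (ℚ; _/_; _+_; _-_; _*_)
ι : ℤ → ℚ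
ι i = i / 1

-- `_/_` normalises and does not reduce on a variable numerator. The comparison is therefore made
-- between unnormalised fractions, where it is a ring identity over ℤ.
ι-+ : ∀ i j → ι (i ℤ.+ j) ≡ ι i + ι j
ι-+ i j = ℚ.toℚᵘ-injective (ℚᵘ.≃-trans (ℚ.toℚᵘ-fromℚᵘ (mkℚᵘ (i ℤ.+ j) 0)) (ℚᵘ.≃-sym (
  ℚᵘ.≃-trans (ℚ.toℚᵘ-homo-+ (ι i) (ι j))
  (ℚᵘ.≃-trans (ℚᵘ.+-cong (ℚ.toℚᵘ-fromℚᵘ (mkℚᵘ i 0)) (ℚ.toℚᵘ-fromℚᵘ (mkℚᵘ j 0)))
    (*≡* (solve 2 (λ i j → (i :* # 1 :+ j :* # 1) :* # 1 := (i :+ j) :* (# 1 :* # 1)) refl i j))))))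

ι-* : ∀ i j → ι (i ℤ.* j) ≡ ι i * ι j
ι-* i j = ℚ.toℚᵘ-injective (ℚᵘ.≃-trans (ℚ.toℚᵘ-fromℚᵘ (mkℚᵘ (i ℤ.* j) 0)) (ℚᵘ.≃-sym (
  ℚᵘ.≃-trans (ℚ.toℚᵘ-homo-* (ι i) (ι j))
  (ℚᵘ.≃-trans (ℚᵘ.*-cong (ℚ.toℚᵘ-fromℚᵘ (mkℚᵘ i 0)) (ℚ.toℚᵘ-fromℚᵘ (mkℚᵘ j 0)))
    (*≡* (solve 2 (λ i j → (i :* j) :* # 1 := (i :* j) :* (# 1 :* # 1)) refl i j))))))

ι-linear : ∀ c d i j → ι (c ℤ.* i ℤ.+ d ℤ.* j) ≡ ι c * ι i + ι d * ι j
ι-linear c d i j = trans (ι-+ (c ℤ.* i) (d ℤ.* j)) (cong₂ _+_ (ι-* c i) (ι-* d j))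

sumℚ-scale : ∀ {A : Set} (f : A → ℚ) (g : A → ℤ) c → (∀ x → f x ≡ c * ι (g x)) →
  ∀ xs → sumℚ (map f xs) ≡ c * ι (sumℤ (map g xs))
sumℚ-scale f g c f≡cg []       = sym (ℚ.*-zeroʳ c)
sumℚ-scale f g c f≡cg (x ∷ xs) = begin
  f x + sumℚ (map f xs)
    ≡⟨ cong₂ _+_ (f≡cg x) (sumℚ-scale f g c f≡cg xs) ⟩
  c * ι (g x) + c * ι (sumℤ (map g xs))
    ≡⟨ sym (ℚ.*-distribˡ-+ c (ι (g x)) (ι (sumℤ (map g xs)))) ⟩
  c * (ι (g x) + ι (sumℤ (map g xs)))
    ≡⟨ cong (c *_) (sym (ι-+ (g x) (sumℤ (map g xs)))) ⟩
  c * ι (sumℤ (map g (x ∷ xs))) ∎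

σ̂≡ : ∀ n → σ̂ n ≡ (+ 1 / 24) * ι (24σ̂ n)
σ̂≡ zero      = refl
σ̂≡ n@(suc _) = begin
  ι (σ^ n)                            ≡⟨ cong ι (σ^≡ n) ⟩
  ι (O 1 n)                           ≡⟨ ℚˢ.solve 1 (λ z → z ℚˢ.:= ℚˢ.con (+ 1 / 24) ℚˢ.:* (ℚˢ.con (+ 24 / 1) ℚˢ.:* z))
       refl (ι (O 1 n)) ⟩
  (+ 1 / 24) * (ι (+ 24) * ι (O 1 n)) ≡⟨ cong ((+ 1 / 24) *_) (sym (ι-* (+ 24) (O 1 n))) ⟩
  (+ 1 / 24) * ι (24σ̂ n)              ∎

-- Each factor σ̂ carries 1/24, whence 576 = 24² here and 13824 = 24³ for triples.
sumℚ-pairs : ∀ n → sumℚ (map (λ (i , j) → σ̂ i * σ̂ j) (pairs n)) ≡ (+ 1 / 576) * ι (conv₀ n n 24σ̂ 24σ̂)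
sumℚ-pairs n = trans
  (sumℚ-scale (λ (i , j) → σ̂ i * σ̂ j) (λ (i , j) → 24σ̂ i ℤ.* 24σ̂ j) (+ 1 / 576) scale (pairs n))
  (cong (λ t → (+ 1 / 576) * ι t) (sumℤ-pairs n 24σ̂ 24σ̂))
  where
  scale : ∀ ((i , j) : ℕ × ℕ) → σ̂ i * σ̂ j ≡ (+ 1 / 576) * ι (24σ̂ i ℤ.* 24σ̂ j)
  scale (i , j) = begin
    σ̂ i * σ̂ j
      ≡⟨ cong₂ _*_ (σ̂≡ i) (σ̂≡ j) ⟩
    (+ 1 / 24) * ι (24σ̂ i) * ((+ 1 / 24) * ι (24σ̂ j))
      ≡⟨ ℚˢ.solve 2 (λ a b → ℚˢ.con (+ 1 / 24) ℚˢ.:* a ℚˢ.:* (ℚˢ.con (+ 1 / 24) ℚˢ.:* b) ℚˢ.:=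
                            ℚˢ.con (+ 1 / 576) ℚˢ.:* (a ℚˢ.:* b)) refl (ι (24σ̂ i)) (ι (24σ̂ j)) ⟩
    (+ 1 / 576) * (ι (24σ̂ i) * ι (24σ̂ j))
      ≡⟨ cong ((+ 1 / 576) *_) (sym (ι-* (24σ̂ i) (24σ̂ j))) ⟩
    (+ 1 / 576) * ι (24σ̂ i ℤ.* 24σ̂ j) ∎

sumℚ-triples : ∀ n → sumℚ (map (λ (i , j , k) → σ̂ i * σ̂ j * σ̂ k) (triples n)) ≡
  (+ 1 / 13824) * ι (conv₀ n n (λ m → conv₀ m m 24σ̂ 24σ̂) 24σ̂)
sumℚ-triples n = trans
  (sumℚ-scale (λ (i , j , k) → σ̂ i * σ̂ j * σ̂ k) (λ (i , j , k) → 24σ̂ i ℤ.* 24σ̂ j ℤ.* 24σ̂ k)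
     (+ 1 / 13824) scale (triples n))
  (cong (λ t → (+ 1 / 13824) * ι t) (sumℤ-triples n 24σ̂ 24σ̂ 24σ̂))
  where
  scale : ∀ ((i , j , k) : ℕ × ℕ × ℕ) → σ̂ i * σ̂ j * σ̂ k ≡ (+ 1 / 13824) * ι (24σ̂ i ℤ.* 24σ̂ j ℤ.* 24σ̂ k)
  scale (i , j , k) = begin
    σ̂ i * σ̂ j * σ̂ k
      ≡⟨ cong₂ _*_ (cong₂ _*_ (σ̂≡ i) (σ̂≡ j)) (σ̂≡ k) ⟩
    (+ 1 / 24) * ι (24σ̂ i) * ((+ 1 / 24) * ι (24σ̂ j)) * ((+ 1 / 24) * ι (24σ̂ k))
      ≡⟨ ℚˢ.solve 3 (λ a b c →
           ℚˢ.con (+ 1 / 24) ℚˢ.:* a ℚˢ.:* (ℚˢ.con (+ 1 / 24) ℚˢ.:* b)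
             ℚˢ.:* (ℚˢ.con (+ 1 / 24) ℚˢ.:* c) ℚˢ.:=
                              ℚˢ.con (+ 1 / 13824) ℚˢ.:* (a ℚˢ.:* b ℚˢ.:* c))
                                   refl (ι (24σ̂ i)) (ι (24σ̂ j)) (ι (24σ̂ k)) ⟩
    (+ 1 / 13824) * (ι (24σ̂ i) * ι (24σ̂ j) * ι (24σ̂ k))
      ≡⟨ cong (λ t → (+ 1 / 13824) * (t * ι (24σ̂ k))) (sym (ι-* (24σ̂ i) (24σ̂ j))) ⟩
    (+ 1 / 13824) * (ι (24σ̂ i ℤ.* 24σ̂ j) * ι (24σ̂ k))
      ≡⟨ cong ((+ 1 / 13824) *_) (sym (ι-* (24σ̂ i ℤ.* 24σ̂ j) (24σ̂ k))) ⟩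
    (+ 1 / 13824) * ι (24σ̂ i ℤ.* 24σ̂ j ℤ.* 24σ̂ k) ∎

ι-σ : ∀ k n .{{_ : NonZero n}} → ι (σ k n) ≡ ι (O k n) + ι (V k n)
ι-σ k n = trans (cong ι (σ≡ k n)) (ι-+ (O k n) (V k n))

ι-σ~ : ∀ k n .{{_ : NonZero n}} → ι (σ~ k n) ≡ ι (O k n) - ι (V k n)
ι-σ~ k n = begin
  ι (σ~ k n)
    ≡⟨ cong ι (trans (σ~≡ k n) (solve 2 (λ o v → o :- v :=
         # 1 :* o :+ con -1ℤ :* v) refl (O k n) (V k n))) ⟩
  ι (1ℤ ℤ.* O k n ℤ.+ -1ℤ ℤ.* V k n)
    ≡⟨ ι-linear 1ℤ -1ℤ (O k n) (V k n) ⟩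
  ι 1ℤ * ι (O k n) + ι -1ℤ * ι (V k n)
    ≡⟨ ℚˢ.solve 2 (λ o v → ℚˢ.con (ι 1ℤ) ℚˢ.:* o ℚˢ.:+ ℚˢ.con (ι -1ℤ) ℚˢ.:* v ℚˢ.:= o ℚˢ.:- v)
         refl (ι (O k n)) (ι (V k n)) ⟩
  ι (O k n) - ι (V k n) ∎

theorem3p3 : (n : ℕ) →
    ((+ 5 / 1) * σ₃ n - σ~₃ n
    ≡ (+ 48 / 1) * sumℚ (map (λ (i , j) → σ̂ i * σ̂ j) (pairs n)))
    ×
    ((+ 7 / 1) * σ₅ n + σ~₅ n
    ≡ (+ 1536 / 1) * sumℚ (map (λ (i , j , k) → σ̂ i * σ̂ j * σ̂ k) (triples n)))
-- Both sides are closed rationals: 5/240 + 1/16 = 48/24² = 1/12 and - 7/504 + 1/8 = 1536/24³ = 1/9.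
theorem3p3 zero      = refl , refl
theorem3p3 n@(suc _) = (begin
  (+ 5 / 1) * ι (σ 3 n) - ι (σ~ 3 n)
    ≡⟨ cong₂ (λ s t → (+ 5 / 1) * s - t) (ι-σ 3 n) (ι-σ~ 3 n) ⟩
  (+ 5 / 1) * (ι (O 3 n) + ι (V 3 n)) - (ι (O 3 n) - ι (V 3 n))
    -- The left side is 4 o + 6 v, a twelfth of 48 o + 72 v, and 48/576 = 1/12.
    ≡⟨ ℚˢ.solve 2 (λ o v → ℚˢ.con (+ 5 / 1) ℚˢ.:* (o ℚˢ.:+ v) ℚˢ.:- (o ℚˢ.:- v) ℚˢ.:=
         ℚˢ.con (+ 48 / 1) ℚˢ.:* (ℚˢ.con (+ 1 / 576) ℚˢ.:*
           (ℚˢ.con (+ 48 / 1) ℚˢ.:* o ℚˢ.:+ ℚˢ.con (+ 72 / 1) ℚˢ.:* v)))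
         refl (ι (O 3 n)) (ι (V 3 n)) ⟩
  (+ 48 / 1) * ((+ 1 / 576) * (ι (+ 48) * ι (O 3 n) + ι (+ 72) * ι (V 3 n)))
    ≡⟨ cong (λ t → (+ 48 / 1) * ((+ 1 / 576) * t))
         (sym (trans (cong ι (convolution-square n)) (ι-linear (+ 48) (+ 72) (O 3 n) (V 3 n)))) ⟩
  (+ 48 / 1) * ((+ 1 / 576) * ι (conv₀ n n 24σ̂ 24σ̂))
    ≡⟨ cong ((+ 48 / 1) *_) (sym (sumℚ-pairs n)) ⟩
  (+ 48 / 1) * sumℚ (map (λ (i , j) → σ̂ i * σ̂ j) (pairs n)) ∎) , (begin
  (+ 7 / 1) * ι (σ 5 n) + ι (σ~ 5 n)
    ≡⟨ cong₂ (λ s t → (+ 7 / 1) * s + t) (ι-σ 5 n) (ι-σ~ 5 n) ⟩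
  (+ 7 / 1) * (ι (O 5 n) + ι (V 5 n)) + (ι (O 5 n) - ι (V 5 n))
    -- The left side is 8 o + 6 v, a ninth of 72 o + 54 v, and 1536/13824 = 1/9.
    ≡⟨ ℚˢ.solve 2 (λ o v → ℚˢ.con (+ 7 / 1) ℚˢ.:* (o ℚˢ.:+ v) ℚˢ.:+ (o ℚˢ.:- v) ℚˢ.:=
         ℚˢ.con (+ 1536 / 1) ℚˢ.:* (ℚˢ.con (+ 1 / 13824) ℚˢ.:*
           (ℚˢ.con (+ 72 / 1) ℚˢ.:* o ℚˢ.:+ ℚˢ.con (+ 54 / 1) ℚˢ.:* v)))
         refl (ι (O 5 n)) (ι (V 5 n)) ⟩
  (+ 1536 / 1) * ((+ 1 / 13824) * (ι (+ 72) * ι (O 5 n) + ι (+ 54) * ι (V 5 n)))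
    ≡⟨ cong (λ t → (+ 1536 / 1) * ((+ 1 / 13824) * t))
         (sym (trans (cong ι (convolution-cube n)) (ι-linear (+ 72) (+ 54) (O 5 n) (V 5 n)))) ⟩
  (+ 1536 / 1) * ((+ 1 / 13824) * ι (conv₀ n n (λ m → conv₀ m m 24σ̂ 24σ̂) 24σ̂))
    ≡⟨ cong ((+ 1536 / 1) *_) (sym (sumℚ-triples n)) ⟩
  (+ 1536 / 1) * sumℚ (map (λ (i , j , k) → σ̂ i * σ̂ j * σ̂ k) (triples n)) ∎)
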